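{- Let $G$ be an almost linear minimal group. Then, for some prime $p$, either $G$ is elementary abelian of exponent $p$, or $G$ is a finite (direct) sum of Prüfer $p$-groups. In particular, $G$ is a torsion group.
   Context: An infinite first-order structure $M$ is minimal if every subset of $M$ definable in $M$ with parameters is finite or co-finite. A minimal group is a minimal structure which is a group, possibly with additional first-order structure. The generic type of a minimal structure $M$ is the unique non-algebraic type $p\in S_1(M)$; let $\bar M\succ M$ be a monster model and $p(\bar M)$ the set of realizations of $p$ in $\bar M$. For a strict partial order $<$, incomparability is the relation $x\sim y$ iff $\neg(x<y\vee y<x)$. A strict partial order $<$ on $M$, definable with parameters and having infinite chains, is almost linear if $\sim$ is an equivalence relation on $p(\bar M)$. The structure $M$ is almost linear if such an order exists. -}

module Defs where

open import Algebra.Bundles using (Group; AbelianGroup)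
open import Algebra.Definitions using (Commutative)
open import Algebra.Morphism.Structures using (module GroupMorphisms)
open import Algebra.Structures using (IsGroup)
import Algebra.Construct.Pointwise as Pointwise
import Algebra.Definitions.RawMonoid as RawMonoidDefs
open import Data.Empty.Polymorphic using (⊥)
open import Data.Fin using (Fin)
open import Data.Integer as ℤ using (ℤ; +_)
import Data.Integer.Properties as ℤ
open import Data.List.Relation.Unary.All using (All)
import Data.List.Membership.Setoid as Membership
open import Data.Nat as ℕ using (ℕ; suc; _≤_; _<_)
import Data.Nat.Properties as ℕ
open import Data.Product using (Σ-syntax; ∃; ∃-syntax; _×_; _,_; proj₁; proj₂)
open import Data.Rational.Unnormalised as ℚ using (ℚᵘ; _≃_; _/_; 0ℚᵘ; *≡*)
import Data.Rational.Unnormalised.Properties as ℚ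
open import Data.Rational.Unnormalised.Solver using (module +-*-Solver)
open import Data.Sum using (_⊎_)
open import Data.Vec using (Vec; []; _∷_; _++_; lookup; map)
import Data.Vec.Relation.Binary.Pointwise.Inductive as VecPW
open import Function.Bundles using (_⇔_)
open import Function.Definitions using (Bijective; Congruent)
open import Level using (Level; _⊔_; 0ℓ) renaming (suc to lsuc)
open import Relation.Binary using (Setoid; IsEquivalence; IsStrictPartialOrder; Rel)
import Relation.Binary.PropositionalEquality as ≡
open import Relation.Nullary using (¬_)
open import Relation.Unary using (Pred; U; ∁; _≐_)

open +-*-Solver using (solve; _:+_; _:*_; _:-_; :-_; _:=_)

private variable
  ℓ m a : Level
  k n : ℕ

record Language ℓ : Set (lsuc ℓ) where
  field
    Func : ℕ → Set ℓ
    Relˢ : ℕ → Set ℓ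

data Term (L : Language ℓ) (n : ℕ) : Set ℓ where
  var : Fin n → Term L n
  app : ∀ {k} → Language.Func L k → Vec (Term L n) k → Term L n

infix  6 _≈̇_
infixr 5 _∧̇_
infixr 4 _∨̇_
infixr 3 _⇒̇_

-- De Bruijn: the quantifiers bind variable 0.
data Formula (L : Language ℓ) (n : ℕ) : Set ℓ where
  ⊥̇           : Formula L n
  _≈̇_         : Term L n → Term L n → Formula L n
  rel         : ∀ {k} → Language.Relˢ L k → Vec (Term L n) k → Formula L n
  _∧̇_ _∨̇_ _⇒̇_ : Formula L n → Formula L n → Formula L n
  ∀̇_ ∃̇_       : Formula L (suc n) → Formula L n

record Structure (L : Language ℓ) m : Set (ℓ ⊔ lsuc m) where
  open Language L
  field
    setoid : Setoid m m
  open Setoid setoid public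
  field
    ⟦_⟧ᶠ     : Func k → Vec Carrier k → Carrier
    ⟦⟧ᶠ-cong : ∀ (f : Func k) {xs ys} → VecPW.Pointwise _≈_ xs ys → ⟦ f ⟧ᶠ xs ≈ ⟦ f ⟧ᶠ ys
    ⟦_⟧ʳ     : Relˢ k → Vec Carrier k → Set m
    ⟦⟧ʳ-resp : ∀ (R : Relˢ k) {xs ys} → VecPW.Pointwise _≈_ xs ys → ⟦ R ⟧ʳ xs → ⟦ R ⟧ʳ ys

module _ {L : Language ℓ} (M : Structure L m) where
  open Structure M

  mutual
    eval : Vec Carrier n → Term L n → Carrier
    eval ρ (var i)    = lookup ρ i
    eval ρ (app f ts) = ⟦ f ⟧ᶠ (evals ρ ts)

    evals : Vec Carrier n → Vec (Term L n) k → Vec Carrier k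
    evals ρ []       = []
    evals ρ (t ∷ ts) = eval ρ t ∷ evals ρ ts

  infix 2 _⊨_

  _⊨_ : Vec Carrier n → Formula L n → Set m
  _⊨_ ρ ⊥̇          = ⊥
  _⊨_ ρ (s ≈̇ t)    = eval ρ s ≈ eval ρ t
  _⊨_ ρ (rel R ts) = ⟦ R ⟧ʳ (evals ρ ts)
  _⊨_ ρ (φ ∧̇ ψ)    = _⊨_ ρ φ × _⊨_ ρ ψ
  _⊨_ ρ (φ ∨̇ ψ)    = _⊨_ ρ φ ⊎ _⊨_ ρ ψ
  _⊨_ ρ (φ ⇒̇ ψ)    = _⊨_ ρ φ → _⊨_ ρ ψ
  _⊨_ ρ (∀̇ φ)      = ∀ x → _⊨_ (x ∷ ρ) φ
  _⊨_ ρ (∃̇ φ)      = ∃[ x ] _⊨_ (x ∷ ρ) φ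

-- A formula in k free variables with a tuple of parameters named by A.
ParamFormula : Language ℓ → ℕ → Set a → Set (ℓ ⊔ a)
ParamFormula L k A = ∃[ n ] Formula L (k ℕ.+ n) × Vec A n

¬ᵖ_ : {L : Language ℓ} {A : Set a} → ParamFormula L k A → ParamFormula L k A
¬ᵖ (n , φ , as) = n , (φ ⇒̇ ⊥̇) , as

module _ {L : Language ℓ} (M : Structure L m) where
  open Structure M using (Carrier)

  -- ι says which element of M each parameter name denotes.
  Holds : {A : Set a} (ι : A → Carrier) → ParamFormula L k A → Vec Carrier k → Set m
  Holds ι (n , φ , as) xs = _⊨_ M (xs ++ map ι as) φ

  Solutions : {A : Set a} (ι : A → Carrier) → ParamFormula L 1 A → Pred Carrier m
  Solutions ι φ x = Holds ι φ (x ∷ [])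

  Realises : {A : Set a} (ι : A → Carrier) → Pred (ParamFormula L 1 A) ℓ → Pred Carrier (ℓ ⊔ a ⊔ m)
  Realises ι Φ x = ∀ φ → Φ φ → Solutions ι φ x

  FinitelySatisfiable : {A : Set a} (ι : A → Carrier) → Pred (ParamFormula L 1 A) ℓ → Set (ℓ ⊔ a ⊔ m)
  FinitelySatisfiable ι Φ = ∀ φs → All Φ φs → ∃[ x ] All (λ φ → Solutions ι φ x) φs

module _ (S : Setoid m m) where
  open Setoid S
  open Membership S using (_∈_)

  Finite : Pred Carrier a → Set (m ⊔ a)
  Finite P = ∃[ xs ] ∀ x → P x → x ∈ xs

  Infinite : Pred Carrier a → Set (m ⊔ a)
  Infinite P = ¬ Finite P

module _ {L : Language ℓ} (M : Structure L ℓ) where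
  open Structure M

  record IsMinimal : Set ℓ where
    field
      infinite : Infinite setoid (U {A = Carrier})
      minimal  : (φ : ParamFormula L 1 Carrier) →
                 let D = Solutions M (λ x → x) φ in Finite setoid D ⊎ Finite setoid (∁ D)

  -- p ∈ S₁(M); consistency with the elementary diagram of M amounts to finite
  -- satisfiability in M itself.
  record IsComplete1Type (p : Pred (ParamFormula L 1 Carrier) ℓ) : Set ℓ where
    field
      consistent : FinitelySatisfiable M (λ x → x) p
      complete   : ∀ φ → p φ ⊎ p (¬ᵖ φ)

  NonAlgebraic : Pred (ParamFormula L 1 Carrier) ℓ → Set ℓ
  NonAlgebraic p = ∀ φ → p φ → Infinite setoid (Solutions M (λ x → x) φ)

  record GenericType : Set (lsuc ℓ) where
    field
      type           : Pred (ParamFormula L 1 Carrier) ℓ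
      isComplete     : IsComplete1Type type
      isNonAlgebraic : NonAlgebraic type
      unique         : ∀ q → IsComplete1Type q → NonAlgebraic q → q ≐ type

module _ {L : Language ℓ} where

  IsElementary : {m n : Level} (M : Structure L m) (N : Structure L n) →
                 (Structure.Carrier M → Structure.Carrier N) → Set (ℓ ⊔ m ⊔ n)
  IsElementary M N f = ∀ {k} (φ : Formula L k) xs → (_⊨_ M xs φ) ⇔ (_⊨_ N (map f xs) φ)

  record Automorphism (N : Structure L m) : Set (ℓ ⊔ m) where
    open Structure N
    field
      σ         : Carrier → Carrier
      cong      : Congruent _≈_ _≈_ σ
      bijective : Bijective _≈_ _≈_ σ
      func      : ∀ {k} (f : Language.Func L k) xs → σ (⟦ f ⟧ᶠ xs) ≈ ⟦ f ⟧ᶠ (map σ xs)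
      relation  : ∀ {k} (R : Language.Relˢ L k) xs → ⟦ R ⟧ʳ xs ⇔ ⟦ R ⟧ʳ (map σ xs)

  -- A κ-saturated and strongly κ-homogeneous elementary extension, with "of size
  -- < κ" rendered as "indexed by a type of Set ℓ", the universe of L and M; the
  -- monster itself lives one universe higher.
  record Monster (M : Structure L ℓ) : Set (lsuc (lsuc ℓ)) where
    field
      M̄          : Structure L (lsuc ℓ)
    open Structure M̄
    field
      embed       : Structure.Carrier M → Carrier
      elementary  : IsElementary M M̄ embed
      saturated   : (I : Set ℓ) (ι : I → Carrier) (Φ : Pred (ParamFormula L 1 I) ℓ) →
                    FinitelySatisfiable M̄ ι Φ → ∃[ x ] Realises M̄ ι Φ x
      homogeneous : (I : Set ℓ) (ι κ : I → Carrier) →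
                    (∀ {n} (φ : Formula L n) is → (_⊨_ M̄ (map ι is) φ) ⇔ (_⊨_ M̄ (map κ is) φ)) →
                    Σ[ α ∈ Automorphism M̄ ] ∀ i → Automorphism.σ α (ι i) ≈ κ i

Incomparable : {A : Set a} → Rel A m → Rel A m
Incomparable _<_ x y = ¬ (x < y ⊎ y < x)

module _ {L : Language ℓ} (M : Structure L ℓ) (𝕄 : Monster M) (p : GenericType M) where
  open Structure M
  open Monster 𝕄
  open GenericType p

  HasInfiniteChain : Rel Carrier ℓ → Set (lsuc ℓ)
  HasInfiniteChain _<_ =
    Σ[ C ∈ Pred Carrier ℓ ] Infinite setoid C × (∀ x y → C x → C y → x < y ⊎ x ≈ y ⊎ y < x)

  -- The set p(M̄).
  Realisation : Set (lsuc ℓ)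
  Realisation = ∃ (Realises M̄ embed type)

  record IsAlmostLinearOrder (φ : ParamFormula L 2 Carrier) : Set (lsuc ℓ) where
    _<ᴹ_ : Rel Carrier ℓ
    x <ᴹ y = Holds M (λ c → c) φ (x ∷ y ∷ [])

    _<ᴹ̄_ : Rel (Structure.Carrier M̄) (lsuc ℓ)
    x <ᴹ̄ y = Holds M̄ embed φ (x ∷ y ∷ [])

    field
      isStrictPartialOrder : IsStrictPartialOrder _≈_ _<ᴹ_
      infiniteChain        : HasInfiniteChain _<ᴹ_
      ∼-isEquivalence      : IsEquivalence {A = Realisation}
                               (λ a b → Incomparable _<ᴹ̄_ (proj₁ a) (proj₁ b))

  AlmostLinear : Set (lsuc ℓ)
  AlmostLinear = ∃ IsAlmostLinearOrder

record ExpandedGroup (L : Language ℓ) : Set (lsuc ℓ) where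
  field
    structure : Structure L ℓ
    mul       : Language.Func L 2
  open Structure structure

  _∙_ : Carrier → Carrier → Carrier
  x ∙ y = ⟦ mul ⟧ᶠ (x ∷ y ∷ [])

  field
    ε       : Carrier
    _⁻¹     : Carrier → Carrier
    isGroup : IsGroup _≈_ _∙_ ε _⁻¹

  group : Group ℓ ℓ
  group = record { isGroup = isGroup }

module _ {c ℓ} (G : Group c ℓ) where
  open Group G
  open RawMonoidDefs rawMonoid using () renaming (_×_ to _·_)

  record HasExponent (n : ℕ) : Set (c ⊔ ℓ) where
    field
      positive    : 0 < n
      annihilates : ∀ x → n · x ≈ ε
      least       : ∀ k → 0 < k → (∀ x → k · x ≈ ε) → n ≤ k

  -- Only used for prime n.
  IsElementaryAbelian : ℕ → Set (c ⊔ ℓ)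
  IsElementaryAbelian n = Commutative _≈_ _∙_ × HasExponent n

  IsTorsion : Set (c ⊔ ℓ)
  IsTorsion = ∀ x → ∃[ n ] 0 < n × n · x ≈ ε

_≅_ : ∀ {c₁ ℓ₁ c₂ ℓ₂} → Group c₁ ℓ₁ → Group c₂ ℓ₂ → Set (c₁ ⊔ ℓ₁ ⊔ c₂ ⊔ ℓ₂)
G ≅ H = ∃ (IsGroupIsomorphism)
  where open GroupMorphisms (Group.rawGroup G) (Group.rawGroup H)

IsInteger : Pred ℚᵘ 0ℓ
IsInteger q = ∃[ z ] q ≃ z / 1

IsInteger-resp : ∀ {q r} → q ≃ r → IsInteger r → IsInteger q
IsInteger-resp q≃r (z , r≃z) = z , ℚ.≃-trans q≃r r≃z

IsInteger-0 : IsInteger 0ℚᵘ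
IsInteger-0 = + 0 , ℚ.≃-refl

IsInteger-+ : ∀ {q r} → IsInteger q → IsInteger r → IsInteger (q ℚ.+ r)
IsInteger-+ (y , q≃y) (z , r≃z) = y ℤ.+ z , ℚ.≃-trans (ℚ.+-cong q≃y r≃z)
  (*≡* (≡.cong (ℤ._* + 1) (≡.cong₂ ℤ._+_ (ℤ.*-identityʳ y) (ℤ.*-identityʳ z))))

IsInteger-neg : ∀ {q} → IsInteger q → IsInteger (ℚ.- q)
IsInteger-neg (z , q≃z) = ℤ.- z , ℚ.-‿cong q≃z

IsInteger-* : ∀ {q r} → IsInteger q → IsInteger r → IsInteger (q ℚ.* r)
IsInteger-* (y , q≃y) (z , r≃z) = y ℤ.* z , ℚ.*-cong q≃y r≃z

private
  p^-+ : ∀ p k l → + (p ℕ.^ (k ℕ.+ l)) / 1 ≃ (+ (p ℕ.^ k) / 1) ℚ.* (+ (p ℕ.^ l) / 1)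
  p^-+ p k l = *≡* (≡.cong (ℤ._* + 1)
    (≡.trans (≡.cong +_ (ℕ.^-distribˡ-+-* p k l)) (ℤ.pos-* (p ℕ.^ k) (p ℕ.^ l))))

-- ℤ[1/p]/ℤ: rationals with a power of p as denominator, identified when their
-- difference is an integer.
module Prüfer (p : ℕ) where

  p^ : ℕ → ℚᵘ
  p^ k = + (p ℕ.^ k) / 1

  ℤ[1/p] : Set
  ℤ[1/p] = Σ[ q ∈ ℚᵘ ] ∃[ k ] IsInteger (q ℚ.* p^ k)

  infix 4 _≈_

  _≈_ : Rel ℤ[1/p] 0ℓ
  x ≈ y = IsInteger (proj₁ x ℚ.- proj₁ y)

  _+_ : ℤ[1/p] → ℤ[1/p] → ℤ[1/p]
  (q , k , i) + (r , l , j) = q ℚ.+ r , k ℕ.+ l ,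
    IsInteger-resp
      (ℚ.≃-trans (ℚ.*-congˡ {q ℚ.+ r} (p^-+ p k l))
        (solve 4 (λ q r a b → (q :+ r) :* (a :* b) := (q :* a) :* b :+ (r :* b) :* a)
          ℚ.≃-refl q r (p^ k) (p^ l)))
      (IsInteger-+ (IsInteger-* i (+ (p ℕ.^ l) , ℚ.≃-refl))
                   (IsInteger-* j (+ (p ℕ.^ k) , ℚ.≃-refl)))

  0# : ℤ[1/p]
  0# = 0ℚᵘ , 0 , + 0 , *≡* ≡.refl

  -_ : ℤ[1/p] → ℤ[1/p]
  - (q , k , i) = ℚ.- q , k ,
    IsInteger-resp (ℚ.≃-sym (ℚ.neg-distribˡ-* q (p^ k))) (IsInteger-neg i)

  ≃⇒≈ : ∀ x y → proj₁ x ≃ proj₁ y → x ≈ y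
  ≃⇒≈ x y eq = IsInteger-resp (ℚ.p≃q⇒p-q≃0 (proj₁ x) (proj₁ y) eq) IsInteger-0

  abelianGroup : AbelianGroup 0ℓ 0ℓ
  abelianGroup = record
    { Carrier = ℤ[1/p] ; _≈_ = _≈_ ; _∙_ = _+_ ; ε = 0# ; _⁻¹ = -_
    ; isAbelianGroup = record
      { isGroup = record
        { isMonoid = record
          { isSemigroup = record
            { isMagma = record
              { isEquivalence = record
                { refl  = λ {x} → ≃⇒≈ x x ℚ.≃-refl
                ; sym   = λ {x} {y} i → IsInteger-resp
                    (solve 2 (λ x y → y :- x := :- (x :- y)) ℚ.≃-refl (proj₁ x) (proj₁ y))
                    (IsInteger-neg i)
                ; trans = λ {x} {y} {z} i j → IsInteger-resp
                    (solve 3 (λ x y z → x :- z := (x :- y) :+ (y :- z)) ℚ.≃-refl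
                      (proj₁ x) (proj₁ y) (proj₁ z))
                    (IsInteger-+ i j)
                }
              ; ∙-cong = λ {x} {y} {u} {v} i j → IsInteger-resp
                  (solve 4 (λ x y u v → (x :+ u) :- (y :+ v) := (x :- y) :+ (u :- v)) ℚ.≃-refl
                    (proj₁ x) (proj₁ y) (proj₁ u) (proj₁ v))
                  (IsInteger-+ i j)
              }
            ; assoc = λ x y z → ≃⇒≈ ((x + y) + z) (x + (y + z))
                        (ℚ.+-assoc (proj₁ x) (proj₁ y) (proj₁ z))
            }
          ; identity = (λ x → ≃⇒≈ (0# + x) x (ℚ.+-identityˡ (proj₁ x)))
                     , (λ x → ≃⇒≈ (x + 0#) x (ℚ.+-identityʳ (proj₁ x)))
          }
        ; inverse = (λ x → ≃⇒≈ ((- x) + x) 0# (ℚ.+-inverseˡ (proj₁ x)))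
                  , (λ x → ≃⇒≈ (x + (- x)) 0# (ℚ.+-inverseʳ (proj₁ x)))
        ; ⁻¹-cong = λ {x} {y} i → IsInteger-resp
            (solve 2 (λ x y → (:- x) :- (:- y) := :- (x :- y)) ℚ.≃-refl (proj₁ x) (proj₁ y))
            (IsInteger-neg i)
        }
      ; comm = λ x y → ≃⇒≈ (x + y) (y + x) (ℚ.+-comm (proj₁ x) (proj₁ y))
      }
    }

-- Over a finite index set the direct sum is the direct power.
Prüfer^ : ℕ → ℕ → Group 0ℓ 0ℓ
Prüfer^ p n = AbelianGroup.group (Pointwise.abelianGroup (Fin n) (Prüfer.abelianGroup p))

IsFiniteSumOfPrüfer : ∀ {c ℓ} → ℕ → Group c ℓ → Set (c ⊔ ℓ)
IsFiniteSumOfPrüfer p G = ∃[ n ] G ≅ Prüfer^ p n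

{-# OPTIONS --safe #-}

-- Saturation is used only once: were incomparability intransitive on triples outside every
-- finite subset of the structure, a bad triple could be realised in p(M̄), point by point.
-- So < is a weak order outside a finite set; as there is an infinite chain, minimality makes
-- its classes finite, its points having either cofinitely many points above them or
-- cofinitely many below them. A definable map f therefore satisfies one of x < f x, x ~ f x,
-- f x < x almost everywhere, while no ascending or descending sequence can leave from the
-- wrong side and no class contains an infinite orbit.
--
-- By Reineke's argument the group is abelian, and for each prime q it is either of exponent q
-- or q-divisible with finite q-torsion. In the divisible case, an element g of infinite order
-- would have a coset x + ℤg outside any given finite set (halving g repeatedly gives infinitely
-- many cosets), contradicting the trichotomy for x ↦ g + x; and torsion for two primes p ≠ r
-- contradicts the trichotomy for x ↦ p x, which has finite orbits on r-torsion but infinite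
-- backward orbits on p-torsion. What remains is a divisible p-group with finite socle; an
-- embedding of a maximal power of the Prüfer group into it is onto.
module Submission where

open import Defs
open import Algebra.Bundles using (Group; AbelianGroup)
import Algebra.Construct.Pointwise as Pointwise
open import Algebra.Definitions using (Commutative)
import Algebra.Definitions.RawMonoid as RawMonoidDefs
import Algebra.Properties.AbelianGroup as AbelianGroupProperties
import Algebra.Properties.CommutativeMonoid.Mult as CommutativeMult
import Algebra.Properties.CommutativeSemigroup as CommutativeSemigroupProperties
import Algebra.Properties.Group as GroupProperties
import Algebra.Properties.Monoid.Mult as Mult
open import Axiom.ExcludedMiddle using (ExcludedMiddle)
open import Data.Empty using (⊥; ⊥-elim)
open import Data.Fin as Fin using (Fin; zero; suc; toℕ; _↑ˡ_; _↑ʳ_)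
import Data.Fin.Properties as Fin
open import Data.Integer as ℤ using (ℤ; +_; -[1+_])
import Data.Integer.DivMod as ℤ
import Data.Integer.Properties as ℤ
open import Data.List as List using (List; []; _∷_; length)
import Data.List.Membership.Setoid as Membership
import Data.List.Membership.Setoid.Properties as Mem
open import Data.List.Relation.Unary.All using (All; []; _∷_)
open import Data.List.Relation.Unary.Any as Any using (here; there)
open import Data.Nat as ℕ using (ℕ; zero; suc; _<_; _≤_; _^_; NonZero)
open import Data.Nat.Coprimality using (Coprime; coprime-Bézout; prime⇒coprime)
open import Data.Nat.Divisibility using (_∣_; ∣m+n∣m⇒∣n; ∣m∣n⇒∣m+n; m∣m*n; ∣1⇒≡1; ∣m⇒∣m*n)
open import Data.Nat.GCD using (module Bézout)
open import Data.Nat.Induction using (<-rec)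
open import Data.Nat.ListAction using (product)
open import Data.Nat.Primality using (Prime; prime[2]; prime⇒irreducible; prime⇒nonZero)
open import Data.Nat.Primality.Factorisation using (factorise; PrimeFactorisation)
import Data.Nat.Properties as ℕ
open import Data.Product using (Σ-syntax; ∃; ∃-syntax; _×_; _,_; proj₁; proj₂)
open import Data.Rational.Unnormalised as ℚ using (ℚᵘ; _≃_; _/_; *≡*)
import Data.Rational.Unnormalised.Properties as ℚ
open import Data.Rational.Unnormalised.Solver using (module +-*-Solver)
open import Data.Sum as Sum using (_⊎_; inj₁; inj₂; [_,_])
open import Data.Vec using (Vec; []; _∷_; _++_; lookup; map; tabulate; fromList)
import Data.Vec.Functional as Vector
open import Data.Vec.Properties
  using (lookup-++ˡ; lookup-++ʳ; lookup-map; map-id; map-∘; map-++; tabulate∘lookup; tabulate-∘)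
open import Function using (_∘_; id)
open import Function.Bundles using (Equivalence)
open import Level using (Level; _⊔_; Lift; lift; lower) renaming (suc to lsuc)
open import Relation.Binary using (Setoid; Rel; IsEquivalence; IsStrictPartialOrder)
open import Relation.Binary.Definitions using (tri<; tri≈; tri>)
open import Relation.Binary.PropositionalEquality as ≡ using (_≡_; _≢_)
import Relation.Binary.Reasoning.Setoid as SetoidReasoning
open import Relation.Nullary using (¬_; yes; no; contradiction)
open import Relation.Nullary.Decidable using (decidable-stable)
open import Relation.Unary using (Pred; U; ∁)

open +-*-Solver using (solve; _:+_; _:*_; _:-_; _:=_)

private variable
  a b c ℓ m : Level
  k n n′ : ℕ

-- Finite and cofinite sets

module FiniteSets (S : Setoid m m) where
  open Setoid S
  open Membership S using (_∈_)

  Cofinite : Pred Carrier a → Set (m ⊔ a)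
  Cofinite P = Finite S (∁ P)

  ⊆-finite : {P : Pred Carrier a} {Q : Pred Carrier b} →
             (∀ {x} → P x → Q x) → Finite S Q → Finite S P
  ⊆-finite P⊆Q (xs , Q∈) = xs , λ x Px → Q∈ x (P⊆Q Px)

  ∪-finite : {P : Pred Carrier a} {Q : Pred Carrier b} →
             Finite S P → Finite S Q → Finite S (λ x → P x ⊎ Q x)
  ∪-finite (xs , P∈) (ys , Q∈) = xs List.++ ys , λ x →
    [ Mem.∈-++⁺ˡ S ∘ P∈ x , Mem.∈-++⁺ʳ S xs ∘ Q∈ x ]

  ≈-finite : (y : Carrier) → Finite S (_≈ y)
  ≈-finite y = y ∷ [] , λ _ → here

  preimage-finite : (f : Carrier → Carrier) {P : Pred Carrier a} → Finite S P →
                    (∀ y → Finite S (λ x → f x ≈ y)) → Finite S (P ∘ f)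
  preimage-finite f {P} (ys , P∈) fibre = ⊆-finite (P∈ _) (go ys)
    where
    go : ∀ ys → Finite S (λ x → f x ∈ ys)
    go []       = [] , λ _ ()
    go (y ∷ ys) = ⊆-finite (λ { (here p) → inj₁ p ; (there p) → inj₂ p })
                           (∪-finite (fibre y) (go ys))

  image-finite : (f : Carrier → Carrier) → (∀ {x y} → x ≈ y → f x ≈ f y) →
                 {P : Pred Carrier a} → Finite S P → Finite S (λ y → ∃[ x ] P x × y ≈ f x)
  image-finite f f-cong (xs , P∈) = List.map f xs , λ y (x , Px , y≈fx) →
    Mem.∈-resp-≈ S (sym y≈fx) (Mem.∈-map⁺ S S f-cong (P∈ x Px))

  injection-≤ : ∀ {n} (s : Fin n → Carrier) → (∀ {i j} → s i ≈ s j → i ≡ j) →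
                (xs : List Carrier) → (∀ i → s i ∈ xs) → n ≤ length xs
  injection-≤ s s-inj xs s∈ = Fin.injective⇒≤ {f = λ i → Any.index (s∈ i)}
    λ {i} {j} eq → s-inj (Mem.index-injective S (s∈ i) (s∈ j) eq)

  pigeonhole : {P : Pred Carrier a} → Finite S P → (s : ℕ → Carrier) → (∀ n → P (s n)) →
               ∃[ i ] ∃[ j ] i < j × s i ≈ s j
  pigeonhole (xs , P∈) s Ps
    with i , j , i<j , eq ← Fin.pigeonhole {n = suc (length xs)} (ℕ.n<1+n _)
                              (λ k → Any.index (P∈ (s (toℕ k)) (Ps (toℕ k))))
    = toℕ i , toℕ j , i<j , Mem.index-injective S (P∈ _ (Ps (toℕ i))) (P∈ _ (Ps (toℕ j))) eq

  ∩-cofinite : (∀ {a} → ExcludedMiddle a) → {P : Pred Carrier a} {Q : Pred Carrier b} →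
               Cofinite P → Cofinite Q → Cofinite (λ x → P x × Q x)
  ∩-cofinite em {P} {Q} P-cof Q-cof = ⊆-finite (λ {x} → cover x) (∪-finite P-cof Q-cof)
    where
    cover : ∀ x → ¬ (P x × Q x) → ¬ P x ⊎ ¬ Q x
    cover x ¬PQ with em {P = P x}
    ... | yes Px = inj₂ λ Qx → ¬PQ (Px , Qx)
    ... | no ¬Px = inj₁ ¬Px

  cofinite-inhabited : (∀ {a} → ExcludedMiddle a) → Infinite S (U {A = Carrier}) →
                       {P : Pred Carrier a} → Cofinite P → ∃ P
  cofinite-inhabited em inf P-cof = decidable-stable em λ none →
    inf (⊆-finite (λ {x} _ Px → none (x , Px)) P-cof)

-- Multiples in groups

module GroupMultiples (G : Group c ℓ) where
  open Group G
  open GroupProperties G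
  open Mult monoid public
    using (×-congʳ; ×-congˡ; ×-homo-+; ×-homo-1; ×-assocˡ) renaming (_×_ to _·_)
  open SetoidReasoning setoid

  ·-≈⇒annihilated : ∀ {m n} x → m < n → m · x ≈ n · x → ∃[ k ] 0 < k × k · x ≈ ε
  ·-≈⇒annihilated {m} {n} x m<n eq = n ℕ.∸ m , ℕ.m<n⇒0<n∸m m<n , ∙-cancelˡ (m · x) _ _ (begin
    m · x ∙ (n ℕ.∸ m) · x     ≈⟨ ×-homo-+ x m (n ℕ.∸ m) ⟨
    (m ℕ.+ (n ℕ.∸ m)) · x     ≈⟨ ×-congˡ (ℕ.m+[n∸m]≡n (ℕ.<⇒≤ m<n)) ⟩
    n · x                     ≈⟨ eq ⟨
    m · x                     ≈⟨ identityʳ _ ⟨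
    m · x ∙ ε                 ∎)

module Multiples (A : AbelianGroup c ℓ) where
  open AbelianGroup A
  open AbelianGroupProperties A
  open GroupMultiples group public
  open CommutativeMult commutativeMonoid public using (×-distrib-+)
  open SetoidReasoning setoid

  ·-comm : ∀ m n x → m · (n · x) ≈ n · (m · x)
  ·-comm m n x = begin
    m · (n · x)   ≈⟨ ×-assocˡ x m n ⟩
    (m ℕ.* n) · x ≈⟨ ×-congˡ (ℕ.*-comm m n) ⟩
    (n ℕ.* m) · x ≈⟨ ×-assocˡ x n m ⟨
    n · (m · x)   ∎

  ·-ε : ∀ n → n · ε ≈ ε
  ·-ε zero    = refl
  ·-ε (suc n) = trans (identityˡ _) (·-ε n)

  ·-⁻¹ : ∀ n x → n · (x ⁻¹) ≈ (n · x) ⁻¹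
  ·-⁻¹ n x = inverseˡ-unique _ _ (begin
    n · (x ⁻¹) ∙ n · x ≈⟨ ×-distrib-+ (x ⁻¹) x n ⟨
    n · (x ⁻¹ ∙ x)   ≈⟨ ×-congʳ n (inverseˡ x) ⟩
    n · ε            ≈⟨ ·-ε n ⟩
    ε                ∎)

  ·-multiple : ∀ m {n x} → n · x ≈ ε → (m ℕ.* n) · x ≈ ε
  ·-multiple m {n} {x} nx≈ε = trans (sym (×-assocˡ x m n)) (trans (×-congʳ m nx≈ε) (·-ε m))

  -- By Bézout one of the numbers `a m`, `b n` exceeds the other by one. Natural coefficients leave
  -- two symmetric cases.
  coprime-annihilators : ∀ {m n} → Coprime m n → ∀ {x} → m · x ≈ ε → n · x ≈ ε → x ≈ ε
  coprime-annihilators {m} {n} cop {x} mx≈ε nx≈ε with coprime-Bézout cop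
  ... | Bézout.+- a b eq = begin
    x                   ≈⟨ identityʳ x ⟨
    x ∙ ε               ≈⟨ ∙-congˡ (·-multiple b nx≈ε) ⟨
    suc (b ℕ.* n) · x   ≈⟨ ×-congˡ eq ⟩
    (a ℕ.* m) · x       ≈⟨ ·-multiple a mx≈ε ⟩
    ε                   ∎
  ... | Bézout.-+ a b eq = begin
    x                   ≈⟨ identityʳ x ⟨
    x ∙ ε               ≈⟨ ∙-congˡ (·-multiple a mx≈ε) ⟨
    suc (a ℕ.* m) · x   ≈⟨ ×-congˡ eq ⟩
    (b ℕ.* n) · x       ≈⟨ ·-multiple b nx≈ε ⟩
    ε                   ∎

  infixr 8 _·ᶻ_

  _·ᶻ_ : ℤ → Carrier → Carrier
  (+ n)    ·ᶻ x = n · x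
  -[1+ n ] ·ᶻ x = (suc n · x) ⁻¹

  ·ᶻ-cong : ∀ i {x y} → x ≈ y → i ·ᶻ x ≈ i ·ᶻ y
  ·ᶻ-cong (+ n)    x≈y = ×-congʳ n x≈y
  ·ᶻ-cong -[1+ n ] x≈y = ⁻¹-cong (×-congʳ (suc n) x≈y)

  ·ᶻ-ε : ∀ i → i ·ᶻ ε ≈ ε
  ·ᶻ-ε (+ n)    = ·-ε n
  ·ᶻ-ε -[1+ n ] = trans (⁻¹-cong (·-ε (suc n))) ε⁻¹≈ε

  ·ᶻ-neg : ∀ i x → (ℤ.- i) ·ᶻ x ≈ (i ·ᶻ x) ⁻¹
  ·ᶻ-neg (+ zero)  x = sym ε⁻¹≈ε
  ·ᶻ-neg (+ suc n) x = refl
  ·ᶻ-neg -[1+ n ]  x = sym (⁻¹-involutive _)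

  ·ᶻ-⊖ : ∀ m n x → (m ℤ.⊖ n) ·ᶻ x ≈ m · x ∙ (n · x) ⁻¹
  ·ᶻ-⊖ m       zero    x = sym (trans (∙-congˡ ε⁻¹≈ε) (identityʳ _))
  ·ᶻ-⊖ zero    (suc n) x = sym (identityˡ _)
  ·ᶻ-⊖ (suc m) (suc n) x rewrite ℤ.[1+m]⊖[1+n]≡m⊖n m n = begin
    (m ℤ.⊖ n) ·ᶻ x                   ≈⟨ ·ᶻ-⊖ m n x ⟩
    m · x ∙ (n · x) ⁻¹               ≈⟨ ∙-congˡ (xyx⁻¹≈y x _) ⟨
    m · x ∙ (x ∙ (n · x) ⁻¹ ∙ x ⁻¹)  ≈⟨ ∙-congˡ (assoc _ _ _) ⟩
    m · x ∙ (x ∙ ((n · x) ⁻¹ ∙ x ⁻¹)) ≈⟨ assoc _ _ _ ⟨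
    m · x ∙ x ∙ ((n · x) ⁻¹ ∙ x ⁻¹)  ≈⟨ ∙-cong (comm _ _) (sym (⁻¹-anti-homo-∙ x (n · x))) ⟩
    suc m · x ∙ (suc n · x) ⁻¹       ∎

  ·ᶻ-+ : ∀ i j x → (i ℤ.+ j) ·ᶻ x ≈ i ·ᶻ x ∙ j ·ᶻ x
  ·ᶻ-+ (+ m)    (+ n)    x = ×-homo-+ x m n
  ·ᶻ-+ (+ m)    -[1+ n ] x = ·ᶻ-⊖ m (suc n) x
  ·ᶻ-+ -[1+ m ] (+ n)    x = trans (·ᶻ-⊖ n (suc m) x) (comm _ _)
  ·ᶻ-+ -[1+ m ] -[1+ n ] x = begin
    (suc (suc (m ℕ.+ n)) · x) ⁻¹       ≈⟨ ⁻¹-cong (×-congˡ (≡.cong suc (≡.sym (ℕ.+-suc m n)))) ⟩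
    ((suc m ℕ.+ suc n) · x) ⁻¹         ≈⟨ ⁻¹-cong (×-homo-+ x (suc m) (suc n)) ⟩
    (suc m · x ∙ suc n · x) ⁻¹         ≈⟨ ⁻¹-∙-comm _ _ ⟨
    (suc m · x) ⁻¹ ∙ (suc n · x) ⁻¹    ∎

  ·ᶻ-*ʳ : ∀ i n x → (i ℤ.* + n) ·ᶻ x ≈ i ·ᶻ (n · x)
  ·ᶻ-*ʳ (+ m)    n x rewrite ≡.sym (ℤ.pos-* m n) = sym (×-assocˡ x m n)
  ·ᶻ-*ʳ -[1+ m ] n x rewrite ≡.sym (ℤ.neg-distribˡ-* (+ suc m) (+ n))
                           | ≡.sym (ℤ.pos-* (suc m) n) = begin
    (ℤ.- + (suc m ℕ.* n)) ·ᶻ x  ≈⟨ ·ᶻ-neg (+ (suc m ℕ.* n)) x ⟩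
    ((suc m ℕ.* n) · x) ⁻¹      ≈⟨ ⁻¹-cong (×-assocˡ x (suc m) n) ⟨
    (suc m · n · x) ⁻¹          ∎

  ·-power-+ : ∀ q i j x → (q ^ (i ℕ.+ j)) · x ≈ (q ^ i) · (q ^ j) · x
  ·-power-+ q i j x = trans (×-congˡ (ℕ.^-distribˡ-+-* q i j)) (sym (×-assocˡ x (q ^ i) (q ^ j)))

  -- A compatible choice of `q`-power roots of `x`. With `q = 2` it supplies cosets of an element of
  -- infinite order; with `x` of order `q` it supplies infinitely many elements of `q`-power order.
  module Roots (q : ℕ) (divisible : ∀ x → ∃[ y ] q · y ≈ x) (x : Carrier) where

    root : ℕ → Carrier
    root zero    = x
    root (suc k) = proj₁ (divisible (root k))

    q·root : ∀ k → q · root (suc k) ≈ root k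
    q·root k = proj₂ (divisible (root k))

    q^k·root : ∀ k → (q ^ k) · root k ≈ x
    q^k·root zero    = ×-homo-1 x
    q^k·root (suc k) = begin
      (q ℕ.* q ^ k) · root (suc k)    ≈⟨ ×-assocˡ _ q (q ^ k) ⟨
      q · (q ^ k) · root (suc k)      ≈⟨ ·-comm q (q ^ k) _ ⟩
      (q ^ k) · q · root (suc k)      ≈⟨ ×-congʳ (q ^ k) (q·root k) ⟩
      (q ^ k) · root k                ≈⟨ q^k·root k ⟩
      x                               ∎

    q^j·root-i : ∀ {i j} → i ≤ j → (q ^ j) · root i ≈ (q ^ (j ℕ.∸ i)) · x
    q^j·root-i {i} {j} i≤j = begin
      (q ^ j) · root i                    ≡⟨ ≡.cong (λ m → (q ^ m) · root i) (ℕ.m∸n+n≡m i≤j) ⟨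
      (q ^ (j ℕ.∸ i ℕ.+ i)) · root i      ≈⟨ ·-power-+ q (j ℕ.∸ i) i _ ⟩
      (q ^ (j ℕ.∸ i)) · (q ^ i) · root i  ≈⟨ ×-congʳ (q ^ (j ℕ.∸ i)) (q^k·root i) ⟩
      (q ^ (j ℕ.∸ i)) · x                 ∎

    module _ (qx≈ε : q · x ≈ ε) where

      q^j·root-i≈ε : ∀ {i j} → i < j → (q ^ j) · root i ≈ ε
      -- As `i < j`, the exponent `j ∸ i` is a successor, and the spare factor `q` kills `x`.
      q^j·root-i≈ε {i} {j} i<j with j ℕ.∸ i | ℕ.m<n⇒0<n∸m i<j | q^j·root-i (ℕ.<⇒≤ i<j)
      ... | suc m | _ | eq = trans eq (trans (×-congˡ (ℕ.*-comm q (q ^ m))) (·-multiple (q ^ m) qx≈ε))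

      -- Multiplication by `q ^ j` kills the earlier root but carries the later one to `x`.
      multiples-distinct : ∀ m n {i j} → i < j → m · root i ≈ n · root j → n · x ≈ ε
      multiples-distinct m n {i} {j} i<j eq = begin
        n · x                     ≈⟨ ×-congʳ n (q^k·root j) ⟨
        n · (q ^ j) · root j      ≈⟨ ·-comm n (q ^ j) _ ⟩
        (q ^ j) · n · root j      ≈⟨ ×-congʳ (q ^ j) eq ⟨
        (q ^ j) · m · root i      ≈⟨ ·-comm (q ^ j) m _ ⟩
        m · (q ^ j) · root i      ≈⟨ ×-congʳ m (q^j·root-i≈ε i<j) ⟩
        m · ε                     ≈⟨ ·-ε m ⟩
        ε                         ∎

-- Embedding powers of the Prüfer group

private
  /1-injective : ∀ {i j} → i / 1 ≃ j / 1 → i ≡ j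
  /1-injective {i} {j} (*≡* eq) = ℤ.*-cancelʳ-≡ i j (+ 1) eq

  /1-+ : ∀ i j → (i ℤ.+ j) / 1 ≃ i / 1 ℚ.+ j / 1
  /1-+ i j = *≡* (≡.cong (ℤ._* + 1) (≡.sym (≡.cong₂ ℤ._+_ (ℤ.*-identityʳ i) (ℤ.*-identityʳ j))))

  suc/1 : ∀ n → + suc n / 1 ≃ + 1 / 1 ℚ.+ + n / 1
  suc/1 n = /1-+ (+ 1) (+ n)

  module _ where
    open SetoidReasoning ℚ.≃-setoid

    -- Multiply `q - r ≃ u` by the common denominator `a b`, for which `c` stands. With the
    -- denominators kept as variables this is a ring identity.
    numerators-generic : ∀ (q r a b z w u c : ℚᵘ) → q ℚ.* a ≃ z → r ℚ.* b ≃ w → q ℚ.- r ≃ u → c ≃ a ℚ.* b →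
                         z ℚ.* b ≃ u ℚ.* c ℚ.+ w ℚ.* a
    numerators-generic q r a b z w u c qa rb qr ab = begin
      z ℚ.* b                                       ≈⟨ ℚ.*-congʳ {b} qa ⟨
      q ℚ.* a ℚ.* b
        ≈⟨ solve 4 (λ q r a b → q :* a :* b := (q :- r) :* (a :* b) :+ r :* b :* a) ℚ.≃-refl q r a b ⟩
      (q ℚ.- r) ℚ.* (a ℚ.* b) ℚ.+ r ℚ.* b ℚ.* a
        ≈⟨ ℚ.+-cong {(q ℚ.- r) ℚ.* (a ℚ.* b)} {u ℚ.* c} {r ℚ.* b ℚ.* a} {w ℚ.* a}
             (ℚ.*-cong {q ℚ.- r} {u} {a ℚ.* b} {c} qr (ℚ.≃-sym ab)) (ℚ.*-congʳ {a} rb) ⟩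
      u ℚ.* c ℚ.+ w ℚ.* a                           ∎

    +1-* : ∀ (m n q r : ℚᵘ) → m ≃ ℚ.1ℚᵘ ℚ.+ n → r ≃ n ℚ.* q → q ℚ.+ r ≃ m ℚ.* q
    +1-* m n q r m≃ r≃ = begin
      q ℚ.+ r                      ≈⟨ ℚ.+-cong {q} {ℚ.1ℚᵘ ℚ.* q} {r} {n ℚ.* q} (ℚ.≃-sym (ℚ.*-identityˡ q)) r≃ ⟩
      ℚ.1ℚᵘ ℚ.* q ℚ.+ n ℚ.* q      ≈⟨ ℚ.*-distribʳ-+ q ℚ.1ℚᵘ n ⟨
      (ℚ.1ℚᵘ ℚ.+ n) ℚ.* q          ≈⟨ ℚ.*-congʳ {q} m≃ ⟨
      m ℚ.* q                      ∎

    -- In this and the next three lemmas `a` stands for `p` and `b` for `1 / p`; where they occur,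
    -- `c` and `d` are consecutive powers of `p`.
    divide-multiply : ∀ (q a b : ℚᵘ) → b ℚ.* a ≃ ℚ.1ℚᵘ → a ℚ.* (q ℚ.* b) ≃ q
    divide-multiply q a b ba = begin
      a ℚ.* (q ℚ.* b)      ≈⟨ solve 3 (λ a b c → a :* (b :* c) := b :* (c :* a)) ℚ.≃-refl a q b ⟩
      q ℚ.* (b ℚ.* a)      ≈⟨ ℚ.*-congˡ {q} ba ⟩
      q ℚ.* ℚ.1ℚᵘ          ≈⟨ ℚ.*-identityʳ q ⟩
      q                    ∎

    divide-numerator : ∀ (q a b c d z : ℚᵘ) → b ℚ.* a ≃ ℚ.1ℚᵘ → d ≃ a ℚ.* c → q ℚ.* c ≃ z → q ℚ.* b ℚ.* d ≃ z
    divide-numerator q a b c d z ba d≃ qc = begin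
      q ℚ.* b ℚ.* d             ≈⟨ ℚ.*-congˡ {q ℚ.* b} d≃ ⟩
      q ℚ.* b ℚ.* (a ℚ.* c)     ≈⟨ solve 4 (λ q a b c → q :* a :* (b :* c) := (a :* b) :* (q :* c)) ℚ.≃-refl q b a c ⟩
      b ℚ.* a ℚ.* (q ℚ.* c)     ≈⟨ ℚ.*-cong {b ℚ.* a} {ℚ.1ℚᵘ} {q ℚ.* c} {z} ba qc ⟩
      ℚ.1ℚᵘ ℚ.* z               ≈⟨ ℚ.*-identityˡ z ⟩
      z                         ∎

    multiply-numerator : ∀ (q a c d z : ℚᵘ) → d ≃ a ℚ.* c → q ℚ.* d ≃ z → a ℚ.* q ℚ.* c ≃ z
    multiply-numerator q a c d z d≃ qd = begin
      a ℚ.* q ℚ.* c      ≈⟨ solve 3 (λ a q c → a :* q :* c := q :* (a :* c)) ℚ.≃-refl a q c ⟩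
      q ℚ.* (a ℚ.* c)    ≈⟨ ℚ.*-congˡ {q} d≃ ⟨
      q ℚ.* d            ≈⟨ qd ⟩
      z                  ∎

    divide-both : ∀ (q a b z : ℚᵘ) → b ℚ.* a ≃ ℚ.1ℚᵘ → a ℚ.* q ≃ z → q ≃ z ℚ.* b
    divide-both q a b z ba aq = begin
      q                  ≈⟨ ℚ.*-identityʳ q ⟨
      q ℚ.* ℚ.1ℚᵘ        ≈⟨ ℚ.*-congˡ {q} ba ⟨
      q ℚ.* (b ℚ.* a)    ≈⟨ solve 3 (λ a q c → q :* (c :* a) := a :* q :* c) ℚ.≃-refl a q b ⟩
      a ℚ.* q ℚ.* b      ≈⟨ ℚ.*-congʳ {b} aq ⟩
      z ℚ.* b            ∎

-- Multiples of an element of prime order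

module PrimeOrder (p : ℕ) (prime : Prime p) (B : AbelianGroup c ℓ) where
  open AbelianGroup B hiding (_-_)
  open AbelianGroupProperties B
  open Multiples B
  open SetoidReasoning setoid

  private instance
    p≢0 : NonZero p
    p≢0 = prime⇒nonZero prime

  -- The Bézout coefficient of `r` inverts it modulo `p`, up to a sign given by the case of the
  -- identity.
  residue-generates : ∀ {x} → p · x ≈ ε → ∀ {r} → .{{NonZero r}} → r < p → ∃[ j ] j ·ᶻ (r · x) ≈ x
  residue-generates {x} px≈ε {r} r<p with coprime-Bézout (prime⇒coprime prime r<p)
  ... | Bézout.+- a b eq = ℤ.- + b , trans (·ᶻ-neg (+ b) _) (sym (inverseˡ-unique _ _ (begin
          x ∙ b · (r · x)      ≈⟨ ∙-congˡ (×-assocˡ x b r) ⟩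
          suc (b ℕ.* r) · x    ≈⟨ ×-congˡ eq ⟩
          (a ℕ.* p) · x        ≈⟨ ·-multiple a px≈ε ⟩
          ε                    ∎)))
  ... | Bézout.-+ a b eq = + b , (begin
          b · (r · x)          ≈⟨ ×-assocˡ x b r ⟩
          (b ℕ.* r) · x        ≈⟨ ×-congˡ eq ⟨
          x ∙ (a ℕ.* p) · x    ≈⟨ ∙-congˡ (·-multiple a px≈ε) ⟩
          x ∙ ε                ≈⟨ identityʳ x ⟩
          x                    ∎)

  -- Only the residue of `i` modulo `p` matters: it is zero or invertible.
  multiple-generates : ∀ {x} → p · x ≈ ε → ∀ i {y} → y ≈ i ·ᶻ x → y ≈ ε ⊎ ∃[ j ] j ·ᶻ y ≈ x
  multiple-generates {x} px≈ε i {y} y≈ix = go (i ℤ.%ℕ p) ≡.refl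
    where
    y≈residue : y ≈ (i ℤ.%ℕ p) · x
    y≈residue = begin
      y
        ≈⟨ y≈ix ⟩
      i ·ᶻ x
        ≡⟨ ≡.cong (_·ᶻ x) (ℤ.a≡a%ℕn+[a/ℕn]*n i p) ⟩
      (+ (i ℤ.%ℕ p) ℤ.+ i ℤ./ℕ p ℤ.* + p) ·ᶻ x
        ≈⟨ ·ᶻ-+ (+ (i ℤ.%ℕ p)) (i ℤ./ℕ p ℤ.* + p) x ⟩
      (i ℤ.%ℕ p) · x ∙ (i ℤ./ℕ p ℤ.* + p) ·ᶻ x
        ≈⟨ ∙-congˡ (trans (·ᶻ-*ʳ (i ℤ./ℕ p) p x) (trans (·ᶻ-cong (i ℤ./ℕ p) px≈ε) (·ᶻ-ε (i ℤ./ℕ p)))) ⟩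
      (i ℤ.%ℕ p) · x ∙ ε
        ≈⟨ identityʳ _ ⟩
      (i ℤ.%ℕ p) · x ∎

    go : ∀ r → i ℤ.%ℕ p ≡ r → y ≈ ε ⊎ ∃[ j ] j ·ᶻ y ≈ x
    go zero    eq = inj₁ (trans y≈residue (×-congˡ eq))
    go (suc r) eq with j , jrx≈x ← residue-generates px≈ε {suc r} (≡.subst (_< p) eq (ℤ.n%ℕd<d i p))
      = inj₂ (j , trans (·ᶻ-cong j (trans y≈residue (×-congˡ eq))) jrx≈x)

record Hom (B : AbelianGroup c c) (A : AbelianGroup ℓ ℓ) : Set (c ⊔ ℓ) where
  private
    module B = AbelianGroup B
    module Bᴹ = Multiples B
    module Bᴾ = AbelianGroupProperties B
  open AbelianGroup A
  open AbelianGroupProperties A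
  open Multiples A
  field
    φ      : B.Carrier → Carrier
    φ-cong : ∀ {x y} → x B.≈ y → φ x ≈ φ y
    φ-∙    : ∀ x y → φ (x B.∙ y) ≈ φ x ∙ φ y

  φ-ε : φ B.ε ≈ ε
  φ-ε = identityˡ-unique _ _ (trans (sym (φ-∙ B.ε B.ε)) (φ-cong (B.identityˡ B.ε)))

  φ-⁻¹ : ∀ x → φ (x B.⁻¹) ≈ φ x ⁻¹
  φ-⁻¹ x = inverseˡ-unique _ _ (trans (sym (φ-∙ _ x)) (trans (φ-cong (B.inverseˡ x)) φ-ε))

  φ-· : ∀ n x → φ (n Bᴹ.· x) ≈ n · φ x
  φ-· zero    x = φ-ε
  φ-· (suc n) x = trans (φ-∙ x _) (∙-congˡ (φ-· n x))

  φ-·ᶻ : ∀ i x → φ (i Bᴹ.·ᶻ x) ≈ i ·ᶻ φ x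
  φ-·ᶻ (+ n)    x = φ-· n x
  φ-·ᶻ -[1+ n ] x = trans (φ-⁻¹ _) (⁻¹-cong (φ-· (suc n) x))

  φ-injective : (∀ x → φ x ≈ ε → x B.≈ B.ε) → ∀ {x y} → φ x ≈ φ y → x B.≈ y
  φ-injective kernel {x} {y} eq = Bᴾ.x∙y⁻¹≈ε⇒x≈y x y
    (kernel _ (trans (φ-∙ x _) (trans (∙-cong eq (φ-⁻¹ y)) (inverseʳ (φ y)))))

_^ᴬ_ : AbelianGroup c ℓ → ℕ → AbelianGroup c ℓ
B ^ᴬ n = Pointwise.abelianGroup (Fin n) B

-- Maximal embedded powers in a group with finite socle

module DivisibleHulls
  (em : ∀ {a} → ExcludedMiddle a) (p : ℕ) (B : AbelianGroup c c) (A : AbelianGroup ℓ ℓ) where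
  open AbelianGroup A
  open AbelianGroupProperties A
  open Multiples A
  open SetoidReasoning setoid
  private
    module B = AbelianGroup B
    module Bᴹ = Multiples B

  -- In the Prüfer group the generator is 1/p: every nonzero element has it among its
  -- multiples, so a homomorphism which does not kill it is injective.
  module _
    (generator : B.Carrier)
    (generator-below : ∀ b → b B.≈ B.ε ⊎ ∃[ i ] i Bᴹ.·ᶻ b B.≈ generator)
    (divisible : ∀ b → ∃[ d ] p Bᴹ.· d B.≈ b)
    (extension : ∀ x → p · x ≈ ε → ∃[ h ] Hom.φ {B = B} {A = A} h generator ≈ x)
    where

    Socle : Carrier → Set _
    Socle x = p · x ≈ ε

    -- The `basis` is there to bound `n`: its members are distinct elements of the finite socle.
    -- That they lie in the image keeps them distinct from the element that `extend` adds.
    record Embedding (n : ℕ) : Set (c ⊔ ℓ) where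
      field
        hom : Hom (B ^ᴬ n) A
      open Hom hom public
      field
        kernel : ∀ v → φ v ≈ ε → ∀ i → v i B.≈ B.ε

      InImage : Carrier → Set _
      InImage x = ∃[ v ] φ v ≈ x

      field
        basis           : Fin n → Carrier
        basis-injective : ∀ {i j} → basis i ≈ basis j → i ≡ j
        basis-socle     : ∀ i → Socle (basis i)
        basis-image     : ∀ i → InImage (basis i)

      image-∙ : ∀ {x y} → InImage x → InImage y → InImage (x ∙ y)
      image-∙ (v , eq) (w , eq′) = _ , trans (φ-∙ v w) (∙-cong eq eq′)

      image-resp : ∀ {x y} → x ≈ y → InImage x → InImage y
      image-resp x≈y (v , eq) = v , trans eq x≈y

    empty : Embedding 0
    empty = record
      { hom = record { φ = λ _ → ε ; φ-cong = λ _ → refl ; φ-∙ = λ _ _ → sym (identityˡ ε) }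
      ; kernel = λ _ _ ()
      ; basis = λ () ; basis-injective = λ { {()} } ; basis-socle = λ () ; basis-image = λ () }

    -- The new coordinate is mapped by a homomorphism taking `generator` to `x`. Were it nonzero on
    -- the kernel, `generator` would be one of its multiples, and `x` would lie in the old image.
    extend : ∀ {n} (E : Embedding n) x → Socle x → ¬ Embedding.InImage E x → Embedding (suc n)
    extend {n} E x px≈ε x∉ with h , hg≈x ← extension x px≈ε = record
      { hom = record
        { φ      = g
        ; φ-cong = λ v≈w → ∙-cong (H.φ-cong (v≈w zero)) (φ-cong (v≈w ∘ suc))
        ; φ-∙    = λ v w → trans (∙-cong (H.φ-∙ _ _) (φ-∙ _ _)) (interchange _ _ _ _) }
      ; kernel          = λ v gv≈ε → λ
        { zero    → g-kernel v gv≈ε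
        ; (suc i) → kernel (v ∘ suc) (begin
            φ (v ∘ suc)                  ≈⟨ identityˡ _ ⟨
            ε ∙ φ (v ∘ suc)              ≈⟨ ∙-congʳ H.φ-ε ⟨
            H.φ B.ε ∙ φ (v ∘ suc)        ≈⟨ ∙-congʳ (H.φ-cong (g-kernel v gv≈ε)) ⟨
            g v                          ≈⟨ gv≈ε ⟩
            ε                            ∎) i }
      ; basis           = x Vector.∷ basis
      ; basis-injective = λ {i} {j} → injective i j
      ; basis-socle     = λ { zero → px≈ε ; (suc i) → basis-socle i }
      ; basis-image     = λ
        { zero    → generator Vector.∷ (λ _ → B.ε) , trans (∙-cong hg≈x φ-ε) (identityʳ x)
        ; (suc i) → B.ε Vector.∷ proj₁ (basis-image i)
                  , trans (∙-cong H.φ-ε (proj₂ (basis-image i))) (identityˡ _) }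
      }
      where
      open Embedding E
      open CommutativeSemigroupProperties commutativeSemigroup using (interchange)
      module H = Hom h

      g : (Fin (suc n) → B.Carrier) → Carrier
      g v = H.φ (v zero) ∙ φ (v ∘ suc)

      g-kernel : ∀ v → g v ≈ ε → v zero B.≈ B.ε
      g-kernel v gv≈ε with generator-below (v zero)
      ... | inj₁ v₀≈ε       = v₀≈ε
      -- As `g v` is trivial, `H.φ (v zero)` is the image of the inverse of the other coordinates,
      -- and its `i`-th multiple is `x`.
      ... | inj₂ (i , iv₀≈g) = contradiction (_ , (begin
        φ (i ·ⁿ (v′ ⁻¹ⁿ))     ≈⟨ φ-·ᶻ i _ ⟩
        i ·ᶻ φ (v′ ⁻¹ⁿ)       ≈⟨ ·ᶻ-cong i (φ-⁻¹ v′) ⟩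
        i ·ᶻ (φ v′ ⁻¹)        ≈⟨ ·ᶻ-cong i (inverseˡ-unique _ _ gv≈ε) ⟨
        i ·ᶻ H.φ (v zero)     ≈⟨ H.φ-·ᶻ i (v zero) ⟨
        H.φ (i Bᴹ.·ᶻ v zero)  ≈⟨ H.φ-cong iv₀≈g ⟩
        H.φ generator         ≈⟨ hg≈x ⟩
        x                     ∎)) x∉
        where
        open AbelianGroup (B ^ᴬ n) using () renaming (_⁻¹ to _⁻¹ⁿ)
        open Multiples (B ^ᴬ n) using () renaming (_·ᶻ_ to _·ⁿ_)
        v′ = v ∘ suc

      injective : ∀ i j → (x Vector.∷ basis) i ≈ (x Vector.∷ basis) j → i ≡ j
      injective zero    zero    eq = ≡.refl
      injective zero    (suc j) eq = contradiction (image-resp (sym eq) (basis-image j)) x∉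
      injective (suc i) zero    eq = contradiction (image-resp eq (basis-image i)) x∉
      injective (suc i) (suc j) eq = ≡.cong suc (basis-injective eq)

    module _ (socle-finite : Finite setoid Socle) (primary : ∀ x → ∃[ k ] (p ^ k) · x ≈ ε) where

      CoversSocle : ∀ {n} → Embedding n → Set _
      CoversSocle E = ∀ x → Socle x → Embedding.InImage E x

      -- Each extension spends one unit of `fuel`. When none is left, `n` exceeds the length of the
      -- list that enumerates the socle, which the `n` distinct basis elements forbid.
      maximal : ∀ fuel {n} → n ℕ.+ fuel ≡ suc (length (proj₁ socle-finite)) → Embedding n →
                ∃[ m ] ∃ (CoversSocle {m})
      maximal zero    {n} eq E = contradiction
        (FiniteSets.injection-≤ setoid basis basis-injective (proj₁ socle-finite)
          (λ i → proj₂ socle-finite _ (basis-socle i)))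
        (ℕ.<⇒≱ (≡.subst (length (proj₁ socle-finite) <_) (≡.trans (≡.sym eq) (ℕ.+-identityʳ n)) (ℕ.n<1+n _)))
        where
        open Embedding E
      maximal (suc fuel) {n} eq E with em {P = ∃[ x ] Socle x × ¬ Embedding.InImage E x}
      ... | yes (x , px≈ε , x∉) = maximal fuel (≡.trans (≡.sym (ℕ.+-suc n fuel)) eq) (extend E x px≈ε x∉)
      ... | no none = n , E , λ x px≈ε → decidable-stable em λ x∉ → none (x , px≈ε , x∉)

      -- Induction on `k`: take a preimage of `p · x`, divide it by `p`, and correct the result by
      -- an element of the socle.
      surjective : ∀ {n} (E : Embedding n) → CoversSocle E → ∀ k x → (p ^ k) · x ≈ ε → Embedding.InImage E x
      surjective E covers zero    x eq = image-resp (trans (sym eq) (×-homo-1 x)) (_ , φ-ε)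
        where
        open Embedding E
      surjective {n} E covers (suc k) x eq
        with v , φv≈px ← surjective E covers k (p · x) (begin
               (p ^ k) · p · x     ≈⟨ ·-comm (p ^ k) p x ⟩
               p · (p ^ k) · x     ≈⟨ ×-assocˡ x p (p ^ k) ⟩
               (p ℕ.* p ^ k) · x   ≈⟨ eq ⟩
               ε                   ∎)
        = image-resp (begin
            φ w ∙ (x ∙ φ w ⁻¹)      ≈⟨ assoc _ _ _ ⟨
            φ w ∙ x ∙ φ w ⁻¹        ≈⟨ xyx⁻¹≈y (φ w) x ⟩
            x                       ∎)
            (image-∙ (w , refl) (covers _ (begin
              p · (x ∙ φ w ⁻¹)       ≈⟨ ×-distrib-+ x _ p ⟩
              p · x ∙ p · (φ w ⁻¹)   ≈⟨ ∙-congˡ (·-⁻¹ p (φ w)) ⟩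
              p · x ∙ (p · φ w) ⁻¹   ≈⟨ ∙-congˡ (⁻¹-cong pφw≈px) ⟩
              p · x ∙ (p · x) ⁻¹     ≈⟨ inverseʳ _ ⟩
              ε                      ∎)))
        where
        open Embedding E
        open Multiples (B ^ᴬ n) using () renaming (_·_ to _·ⁿ_)

        ·ⁿ-pointwise : ∀ m (u : Fin n → B.Carrier) i → (m ·ⁿ u) i B.≈ m Bᴹ.· u i
        ·ⁿ-pointwise zero    u i = B.refl
        ·ⁿ-pointwise (suc m) u i = B.∙-congˡ (·ⁿ-pointwise m u i)

        w : Fin n → B.Carrier
        w i = proj₁ (divisible (v i))

        pφw≈px : p · φ w ≈ p · x
        pφw≈px = trans (sym (φ-· p w))
          (trans (φ-cong λ i → B.trans (·ⁿ-pointwise p w i) (proj₂ (divisible (v i)))) φv≈px)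

      -- The isomorphism is the inverse of the embedding, given by choosing preimages; its laws are
      -- checked after applying the injective `φ`.
      isomorphicToPower : ∃[ n ] group ≅ AbelianGroup.group (B ^ᴬ n)
      isomorphicToPower
        with n , E , covers ← maximal (suc (length (proj₁ socle-finite))) ≡.refl empty = n , h , record
        { isGroupMonomorphism = record
          { isGroupHomomorphism = record
            { isMonoidHomomorphism = record
              { isMagmaHomomorphism = record
                { isRelHomomorphism = record { cong = λ x≈y → inj (trans (φh _) (trans x≈y (sym (φh _)))) }
                ; homo = λ x y → inj (trans (φh _) (sym (trans (φ-∙ _ _) (∙-cong (φh x) (φh y)))))
                }
              ; ε-homo = inj (trans (φh ε) (sym φ-ε))
              }
            ; ⁻¹-homo = λ x → inj (trans (φh _) (sym (trans (φ-⁻¹ _) (⁻¹-cong (φh x)))))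
            }
          ; injective = λ hx≈hy → trans (sym (φh _)) (trans (φ-cong hx≈hy) (φh _))
          }
        ; surjective = λ v → φ v , λ x≈φv → inj (trans (φh _) x≈φv)
        }
        where
        open Embedding E
        im : ∀ x → InImage x
        im x = surjective E covers (proj₁ (primary x)) x (proj₂ (primary x))
        h : Carrier → (Fin n → B.Carrier)
        h x = proj₁ (im x)
        φh : ∀ x → φ (h x) ≈ x
        φh x = proj₂ (im x)
        inj : ∀ {v w} → φ v ≈ φ w → ∀ i → v i B.≈ w i
        inj = φ-injective kernel

-- The Prüfer group as fractions modulo the integers

module PrüferGroup (p : ℕ) (prime : Prime p) where
  private instance
    p≢0 : NonZero p
    p≢0 = prime⇒nonZero prime

  open Prüfer p using (ℤ[1/p]; p^; 0#; ≃⇒≈) renaming (_≈_ to _≈ₚ_; _+_ to _+ₚ_)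
  private
    module Pᴬ = AbelianGroup (Prüfer.abelianGroup p)
    module Pᴹ = Multiples (Prüfer.abelianGroup p)
  open RawMonoidDefs Pᴬ.rawMonoid using () renaming (_×_ to _·ₚ_)

  private
    p^-+ : ∀ k l → p^ (k ℕ.+ l) ≃ p^ k ℚ.* p^ l
    p^-+ k l = *≡* (≡.cong (ℤ._* + 1)
      (≡.trans (≡.cong +_ (ℕ.^-distribˡ-+-* p k l)) (ℤ.pos-* (p ^ k) (p ^ l))))

    1/p : ℚᵘ
    1/p = + 1 / p

    1/p*p : 1/p ℚ.* (+ p / 1) ≃ + 1 / 1
    1/p*p = helper p
      where
      helper : ∀ n .{{_ : NonZero n}} → (+ 1 / n) ℚ.* (+ n / 1) ≃ + 1 / 1
      helper n@(suc _) = *≡* (≡.trans (ℤ.*-identityʳ (+ 1 ℤ.* + n))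
        (≡.cong (+ 1 ℤ.*_) (≡.cong +_ (≡.sym (ℕ.*-identityʳ n)))))

    p^suc : ∀ k → p^ (suc k) ≃ (+ p / 1) ℚ.* p^ k
    p^suc k = *≡* (≡.cong (ℤ._* + 1) (ℤ.pos-* p (p ^ k)))

  generator : ℤ[1/p]
  generator = 1/p , 1 , + 1 ,
    ℚ.≃-trans (ℚ.*-congˡ {1/p} (ℚ.≃-reflexive (≡.cong (λ n → + n / 1) (ℕ.*-identityʳ p)))) 1/p*p

  ·ₚ-fraction : ∀ n x → proj₁ (n ·ₚ x) ≃ (+ n / 1) ℚ.* proj₁ x
  ·ₚ-fraction zero    x = ℚ.≃-sym (ℚ.*-zeroˡ (proj₁ x))
  ·ₚ-fraction (suc n) x = +1-* (+ suc n / 1) (+ n / 1) (proj₁ x) (proj₁ (n ·ₚ x)) (suc/1 n) (·ₚ-fraction n x)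

  divideₚ : (x : ℤ[1/p]) → ∃[ y ] p ·ₚ y ≈ₚ x
  divideₚ x@(q , k , z , qz) = y , ≃⇒≈ (p ·ₚ y) x
      (ℚ.≃-trans (·ₚ-fraction p y) (divide-multiply q (+ p / 1) 1/p 1/p*p))
    where
    y : ℤ[1/p]
    y = q ℚ.* 1/p , suc k , z , divide-numerator q (+ p / 1) 1/p (p^ k) (p^ (suc k)) (z / 1) 1/p*p (p^suc k) qz

  ·ᶻ-fraction : ∀ i x → proj₁ (i Pᴹ.·ᶻ x) ≃ (i / 1) ℚ.* proj₁ x
  ·ᶻ-fraction (+ n)    x = ·ₚ-fraction n x
  ·ᶻ-fraction -[1+ n ] x = ℚ.≃-trans (ℚ.-‿cong (·ₚ-fraction (suc n) x)) (ℚ.neg-distribˡ-* (+ suc n / 1) (proj₁ x))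

  open PrimeOrder p prime (Prüfer.abelianGroup p) using (multiple-generates)

  p·generator : p Pᴹ.· generator ≈ₚ 0#
  p·generator = + 1 , ℚ.≃-trans (ℚ.+-identityʳ (proj₁ (p ·ₚ generator)))
    (ℚ.≃-trans (·ₚ-fraction p generator) (ℚ.≃-trans (ℚ.*-comm (+ p / 1) 1/p) 1/p*p))

  -- Induction on the exponent of the denominator, applied to `p x`. If `p x` is an integer `i`,
  -- then `x` is `i / p`, a multiple of the generator, which has order `p`. Otherwise the generator
  -- is a multiple of `p x`, hence of `x`.
  generator-below : ∀ x → x ≈ₚ 0# ⊎ ∃[ i ] i Pᴹ.·ᶻ x ≈ₚ generator
  generator-below (q , k , z , qz) = go k q z qz
    where
    go : ∀ k q z (qz : q ℚ.* p^ k ≃ z / 1) →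
         let x = q , k , z , qz in x ≈ₚ 0# ⊎ ∃[ i ] i Pᴹ.·ᶻ x ≈ₚ generator
    go zero    q z qz = inj₁ (z , ℚ.≃-trans (ℚ.+-identityʳ q) (ℚ.≃-trans (ℚ.≃-sym (ℚ.*-identityʳ q)) qz))
    go (suc k) q z qz = [ fromTorsion , fromMultiple ] (go k _ z (proj₂ (proj₂ (proj₂ px))))
      where
      x px : ℤ[1/p]
      x = q , suc k , z , qz
      px = (+ p / 1) ℚ.* q , k , z , multiply-numerator q (+ p / 1) (p^ k) (p^ (suc k)) (z / 1) (p^suc k) qz

      px≈ : px ≈ₚ p Pᴹ.· x
      px≈ = ≃⇒≈ px (p Pᴹ.· x) (ℚ.≃-sym (·ₚ-fraction p x))

      fromTorsion : px ≈ₚ 0# → x ≈ₚ 0# ⊎ ∃[ i ] i Pᴹ.·ᶻ x ≈ₚ generator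
      fromTorsion (i , pq≃i) = multiple-generates {x = generator} p·generator i {x}
        (≃⇒≈ x (i Pᴹ.·ᶻ generator) (ℚ.≃-trans
          (divide-both q (+ p / 1) 1/p (i / 1) 1/p*p (ℚ.≃-trans (ℚ.≃-sym (ℚ.+-identityʳ ((+ p / 1) ℚ.* q))) pq≃i))
          (ℚ.≃-sym (·ᶻ-fraction i generator))))

      fromMultiple : (∃[ i ] i Pᴹ.·ᶻ px ≈ₚ generator) → x ≈ₚ 0# ⊎ ∃[ i ] i Pᴹ.·ᶻ x ≈ₚ generator
      fromMultiple (i , ipx≈g) = inj₂ (i ℤ.* + p , Pᴬ.trans
        {(i ℤ.* + p) Pᴹ.·ᶻ x} {i Pᴹ.·ᶻ (p Pᴹ.· x)} {generator} (Pᴹ.·ᶻ-*ʳ i p x)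
        (Pᴬ.trans {i Pᴹ.·ᶻ (p Pᴹ.· x)} {i Pᴹ.·ᶻ px} {generator}
          (Pᴹ.·ᶻ-cong i {p Pᴹ.· x} {px} (Pᴬ.sym {px} {p Pᴹ.· x} px≈)) ipx≈g))

  numerators : ∀ q r k l z w u → q ℚ.* p^ k ≃ z / 1 → r ℚ.* p^ l ≃ w / 1 → q ℚ.- r ≃ u / 1 →
               z ℤ.* + (p ^ l) ≡ u ℤ.* + (p ^ (k ℕ.+ l)) ℤ.+ w ℤ.* + (p ^ k)
  numerators q r k l z w u qz rw qru = /1-injective (ℚ.≃-trans
    (numerators-generic q r (p^ k) (p^ l) (z / 1) (w / 1) (u / 1) (p^ (k ℕ.+ l)) qz rw qru (p^-+ k l))
    (ℚ.≃-sym (/1-+ (u ℤ.* + (p ^ (k ℕ.+ l))) (w ℤ.* + (p ^ k)))))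

  module _ (A : AbelianGroup ℓ ℓ) where
    open AbelianGroup A hiding (_-_)
    open Multiples A
    open SetoidReasoning setoid

    -- Here `e k` plays the part of `1 / p ^ k`, so the fraction `z / p ^ k` is sent to `z ·ᶻ e k`.
    module Chain (e : ℕ → Carrier) (e-zero : e 0 ≈ ε) (e-suc : ∀ k → p · e (suc k) ≈ e k) where

      descend : ∀ l k → (p ^ l) · e (l ℕ.+ k) ≈ e k
      descend zero    k = ×-homo-1 (e k)
      descend (suc l) k = begin
        (p ℕ.* p ^ l) · e (suc (l ℕ.+ k))  ≈⟨ ×-assocˡ _ p (p ^ l) ⟨
        p · (p ^ l) · e (suc (l ℕ.+ k))    ≈⟨ ·-comm p (p ^ l) _ ⟩
        (p ^ l) · p · e (suc (l ℕ.+ k))    ≈⟨ ×-congʳ (p ^ l) (e-suc (l ℕ.+ k)) ⟩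
        (p ^ l) · e (l ℕ.+ k)              ≈⟨ descend l k ⟩
        e k                                ∎

      annihilates : ∀ k → (p ^ k) · e k ≈ ε
      annihilates k = begin
        (p ^ k) · e k            ≡⟨ ≡.cong (λ j → (p ^ k) · e j) (ℕ.+-identityʳ k) ⟨
        (p ^ k) · e (k ℕ.+ 0)    ≈⟨ descend k 0 ⟩
        e 0                      ≈⟨ e-zero ⟩
        ε                        ∎

      raiseˡ : ∀ z l k → z ·ᶻ e k ≈ (z ℤ.* + (p ^ l)) ·ᶻ e (l ℕ.+ k)
      raiseˡ z l k = begin
        z ·ᶻ e k                              ≈⟨ ·ᶻ-cong z (descend l k) ⟨
        z ·ᶻ (p ^ l) · e (l ℕ.+ k)            ≈⟨ ·ᶻ-*ʳ z (p ^ l) _ ⟨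
        (z ℤ.* + (p ^ l)) ·ᶻ e (l ℕ.+ k)      ∎

      raiseʳ : ∀ z k l → z ·ᶻ e k ≈ (z ℤ.* + (p ^ l)) ·ᶻ e (k ℕ.+ l)
      raiseʳ z k l = trans (raiseˡ z l k)
        (·ᶻ-cong (z ℤ.* + (p ^ l)) (reflexive (≡.cong e (ℕ.+-comm l k))))

      value : ℤ[1/p] → Carrier
      value (_ , k , z , _) = z ·ᶻ e k

      -- Over the common denominator `p ^ (k + l)` the numerators of equal elements differ by a
      -- multiple of `p ^ (k + l)`, which kills `e (k + l)`.
      value-cong : ∀ x y → x ≈ₚ y → value x ≈ value y
      value-cong (q , k , z , qz) (r , l , w , rw) (u , qru) = begin
        z ·ᶻ e k
          ≈⟨ raiseʳ z k l ⟩
        (z ℤ.* + (p ^ l)) ·ᶻ e (k ℕ.+ l)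
          ≡⟨ ≡.cong (_·ᶻ e (k ℕ.+ l)) (numerators q r k l z w u qz rw qru) ⟩
        (u ℤ.* + (p ^ (k ℕ.+ l)) ℤ.+ w ℤ.* + (p ^ k)) ·ᶻ e (k ℕ.+ l)
          ≈⟨ ·ᶻ-+ (u ℤ.* + (p ^ (k ℕ.+ l))) (w ℤ.* + (p ^ k)) _ ⟩
        (u ℤ.* + (p ^ (k ℕ.+ l))) ·ᶻ e (k ℕ.+ l) ∙ (w ℤ.* + (p ^ k)) ·ᶻ e (k ℕ.+ l)
          ≈⟨ ∙-cong (trans (·ᶻ-*ʳ u (p ^ (k ℕ.+ l)) _) (·ᶻ-cong u (annihilates (k ℕ.+ l)))) (sym (raiseˡ w k l)) ⟩
        u ·ᶻ ε ∙ w ·ᶻ e l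
          ≈⟨ ∙-congʳ (·ᶻ-ε u) ⟩
        ε ∙ w ·ᶻ e l
          ≈⟨ identityˡ _ ⟩
        w ·ᶻ e l ∎

      value-+ : ∀ x y → value (x +ₚ y) ≈ value x ∙ value y
      value-+ (q , k , z , qz) (r , l , w , rw) = begin
        -- This is the numerator to which the definition of `_+ₚ_` computes.
        (z ℤ.* + (p ^ l) ℤ.+ w ℤ.* + (p ^ k)) ·ᶻ e (k ℕ.+ l)
          ≈⟨ ·ᶻ-+ (z ℤ.* + (p ^ l)) (w ℤ.* + (p ^ k)) _ ⟩
        (z ℤ.* + (p ^ l)) ·ᶻ e (k ℕ.+ l) ∙ (w ℤ.* + (p ^ k)) ·ᶻ e (k ℕ.+ l)
          ≈⟨ ∙-cong (raiseʳ z k l) (raiseˡ w k l) ⟨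
        z ·ᶻ e k ∙ w ·ᶻ e l ∎

    module _ (em : ∀ {a} → ExcludedMiddle a)
             (divisible : ∀ x → ∃[ y ] p · y ≈ x)
             (socle-finite : Finite setoid (λ x → p · x ≈ ε))
             (primary : ∀ x → ∃[ k ] (p ^ k) · x ≈ ε) where

      extension : ∀ x → p · x ≈ ε → ∃[ h ] Hom.φ {B = Prüfer.abelianGroup p} {A = A} h generator ≈ x
      extension x px≈ε = record { φ = value ; φ-cong = λ {y} {z} → value-cong y z ; φ-∙ = value-+ }
                       , ×-homo-1 x
        where
        roots : ℕ → Carrier
        roots zero    = x
        roots (suc k) = proj₁ (divisible (roots k))

        -- The shift by one makes `e 1`, the image of `1 / p`, equal to `x`.
        e : ℕ → Carrier
        e zero    = ε
        e (suc k) = roots k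

        e-suc : ∀ k → p · e (suc k) ≈ e k
        e-suc zero    = px≈ε
        e-suc (suc k) = proj₂ (divisible (roots k))

        open Chain e refl e-suc

      isFiniteSumOfPrüfer : IsFiniteSumOfPrüfer p group
      isFiniteSumOfPrüfer = DivisibleHulls.isomorphicToPower em p (Prüfer.abelianGroup p) A
        generator generator-below divideₚ extension socle-finite primary

-- Almost weak orders

module Eventually (em : ∀ {a} → ExcludedMiddle a) (S : Setoid ℓ ℓ) where
  open Setoid S
  open Membership S using (_∈_)

  -- A sequence without repetitions meets each listed element at most once, and `K` lies beyond all
  -- these meetings.
  eventually-outside : {P : Pred Carrier a} → Finite S P → (s : ℕ → Carrier) →
                       (∀ {i j} → i < j → ¬ s i ≈ s j) → ∃[ K ] ∀ k → K ≤ k → ¬ P (s k)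
  eventually-outside (xs , P∈) s s-inj =
    proj₁ (go xs) , λ k K≤k → proj₂ (go xs) k K≤k ∘ P∈ (s k)
    where
    go : ∀ xs → ∃[ K ] ∀ k → K ≤ k → ¬ (s k ∈ xs)
    go []       = 0 , λ _ _ ()
    go (x ∷ xs) with go xs | em {P = ∃[ k ] s k ≈ x}
    ... | K , outside | no never = K , λ
      { k K≤k (here sk≈x) → never (k , sk≈x) ; k K≤k (there sk∈) → outside k K≤k sk∈ }
    ... | K , outside | yes (k₀ , sk₀≈x) = K ℕ.⊔ suc k₀ , λ
      { k K≤k (here sk≈x) → s-inj (ℕ.≤-trans (ℕ.m≤n⊔m K (suc k₀)) K≤k) (trans sk₀≈x (sym sk≈x))
      ; k K≤k (there sk∈) → outside k (ℕ.≤-trans (ℕ.m≤m⊔n K (suc k₀)) K≤k) sk∈ }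

-- What an almost linear order leaves behind in the structure itself: transitivity of
-- incomparability off a finite set, and minimality for the two cones of each element.
record AlmostWeakOrder (S : Setoid ℓ ℓ) : Set (lsuc ℓ) where
  open Setoid S
  open FiniteSets S using (Cofinite)
  infix 4 _≺_ _∼_
  field
    _≺_                  : Rel Carrier ℓ
    isStrictPartialOrder : IsStrictPartialOrder _≈_ _≺_

  _∼_ : Rel Carrier ℓ
  x ∼ y = Incomparable _≺_ x y

  field
    generic         : Pred Carrier ℓ
    generic-cofinite : Cofinite generic
    ∼-trans         : ∀ {x y z} → generic x → generic y → generic z → x ∼ y → y ∼ z → x ∼ z
    chain           : Pred Carrier ℓ
    chain-infinite  : Infinite S chain
    chain-linear    : ∀ x y → chain x → chain y → x ≺ y ⊎ x ≈ y ⊎ y ≺ x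
    below-minimal   : ∀ y → Finite S (_≺ y) ⊎ Cofinite (_≺ y)
    above-minimal   : ∀ y → Finite S (y ≺_) ⊎ Cofinite (y ≺_)

  open IsStrictPartialOrder isStrictPartialOrder public
    using (irrefl; <-respˡ-≈; <-respʳ-≈) renaming (trans to ≺-trans)

module OrderDichotomy (em : ∀ {a} → ExcludedMiddle a) {S : Setoid ℓ ℓ} (order : AlmostWeakOrder S) where
  open Setoid S
  open FiniteSets S
  open AlmostWeakOrder order

  ∼-refl : ∀ x → x ∼ x
  ∼-refl x (inj₁ x≺x) = irrefl refl x≺x
  ∼-refl x (inj₂ x≺x) = irrefl refl x≺x

  ∼-sym : ∀ {x y} → x ∼ y → y ∼ x
  ∼-sym x∼y (inj₁ y≺x) = x∼y (inj₂ y≺x)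
  ∼-sym x∼y (inj₂ x≺y) = x∼y (inj₁ x≺y)

  ∼-respʳ : ∀ {x y z} → x ≈ y → z ∼ x → z ∼ y
  ∼-respʳ x≈y z∼x (inj₁ z≺y) = z∼x (inj₁ (<-respʳ-≈ (sym x≈y) z≺y))
  ∼-respʳ x≈y z∼x (inj₂ y≺z) = z∼x (inj₂ (<-respˡ-≈ (sym x≈y) y≺z))

  -- Were both cones of x finite, two elements of the chain would be incomparable with x
  -- and so with each other.
  cone-cofinite : ∀ {x} → generic x → Cofinite (_≺ x) ⊎ Cofinite (x ≺_)
  cone-cofinite {x} gx with below-minimal x | above-minimal x
  ... | inj₂ below | _ = inj₁ below
  ... | inj₁ _ | inj₂ above = inj₂ above
  ... | inj₁ below | inj₁ above = contradiction chain-finite chain-infinite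
    where
    NearX : Pred Carrier _
    NearX c = chain c × generic c × c ∼ x

    near-unique : ∀ {c d} → NearX c → NearX d → d ≈ c
    near-unique {c} {d} (Cc , gc , c∼x) (Cd , gd , d∼x) with chain-linear d c Cd Cc
    ... | inj₁ d≺c        = contradiction (inj₁ d≺c) (∼-trans gd gx gc d∼x (∼-sym c∼x))
    ... | inj₂ (inj₁ d≈c) = d≈c
    ... | inj₂ (inj₂ c≺d) = contradiction (inj₂ c≺d) (∼-trans gd gx gc d∼x (∼-sym c∼x))

    near-finite : Finite S NearX
    near-finite with em {P = ∃ NearX}
    ... | yes (c , near) = ⊆-finite (near-unique near) (≈-finite c)
    ... | no none        = [] , λ c near → contradiction (c , near) none

    chain-finite : Finite S chain
    chain-finite = ⊆-finite cover (∪-finite (∪-finite below above) (∪-finite generic-cofinite near-finite))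
      where
      cover : ∀ {c} → chain c → (c ≺ x ⊎ x ≺ c) ⊎ (¬ generic c ⊎ NearX c)
      cover {c} Cc with em {P = c ≺ x ⊎ x ≺ c} | em {P = generic c}
      ... | yes comparable | _ = inj₁ comparable
      ... | no c∼x | no ¬gc = inj₂ (inj₁ ¬gc)
      ... | no c∼x | yes gc = inj₂ (inj₂ (Cc , gc , c∼x))

  -- The class of `x` misses both cones of `x`, one of which is cofinite.
  ∼-finite : ∀ {x} → generic x → Finite S (_∼ x)
  ∼-finite gx with cone-cofinite gx
  ... | inj₁ below = ⊆-finite (λ y∼x y≺x → y∼x (inj₁ y≺x)) below
  ... | inj₂ above = ⊆-finite (λ y∼x x≺y → y∼x (inj₂ x≺y)) above

  module _ (s : ℕ → Carrier) where

    Ascending Descending : Set _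
    Ascending  = ∀ n → s n ≺ s (suc n)
    Descending = ∀ n → s (suc n) ≺ s n

    ascending-≺ : Ascending → ∀ {i j} → i < j → s i ≺ s j
    ascending-≺ asc {i} {suc j} i<1+j with ℕ.m≤n⇒m<n∨m≡n (ℕ.≤-pred i<1+j)
    ... | inj₁ i<j    = ≺-trans (ascending-≺ asc i<j) (asc j)
    ... | inj₂ ≡.refl = asc j

    descending-≺ : Descending → ∀ {i j} → i < j → s j ≺ s i
    descending-≺ desc {i} {suc j} i<1+j with ℕ.m≤n⇒m<n∨m≡n (ℕ.≤-pred i<1+j)
    ... | inj₁ i<j    = ≺-trans (desc j) (descending-≺ desc i<j)
    ... | inj₂ ≡.refl = desc j

    ascending-infinite : Ascending → {P : Pred Carrier a} → (∀ n → P (s n)) → Infinite S P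
    ascending-infinite asc Ps P-fin with i , j , i<j , eq ← pigeonhole P-fin s Ps =
      irrefl eq (ascending-≺ asc i<j)

    descending-infinite : Descending → {P : Pred Carrier a} → (∀ n → P (s n)) → Infinite S P
    descending-infinite desc Ps P-fin with i , j , i<j , eq ← pigeonhole P-fin s Ps =
      irrefl (sym eq) (descending-≺ desc i<j)

    -- The terms of the sequence are infinitely many, and none of them lies below the first.
    ascending-not-below : Ascending → ¬ Cofinite (_≺ s 0)
    ascending-not-below asc = ascending-infinite asc λ
      { zero    → irrefl refl
      ; (suc n) s≺s₀ → irrefl refl (≺-trans (ascending-≺ asc (ℕ.s≤s ℕ.z≤n)) s≺s₀) }

    descending-not-above : Descending → ¬ Cofinite (s 0 ≺_)
    descending-not-above desc = descending-infinite desc λ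
      { zero    → irrefl refl
      ; (suc n) s₀≺s → irrefl refl (≺-trans s₀≺s (descending-≺ desc (ℕ.s≤s ℕ.z≤n))) }

    -- Transitivity on generic elements keeps the whole sequence in the finite class of its first
    -- term.
    constant-repeats : (∀ n → generic (s n)) → (∀ n → s (suc n) ∼ s n) → ∃[ i ] ∃[ j ] i < j × s i ≈ s j
    constant-repeats gs step = pigeonhole (∼-finite (gs 0)) s to-start
      where
      to-start : ∀ n → s n ∼ s 0
      to-start zero    = ∼-refl (s 0)
      to-start (suc n) = ∼-trans (gs (suc n)) (gs n) (gs 0) (step n) (to-start n)

  data Drift (f : Carrier → Carrier) : Set ℓ where
    upward   : Cofinite (λ x → x ≺ f x) → Drift f
    downward : Cofinite (λ x → f x ≺ x) → Drift f
    level    : Cofinite (λ x → f x ∼ x) → Drift f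

  drift : (f : Carrier → Carrier) →
          Finite S (λ x → x ≺ f x) ⊎ Cofinite (λ x → x ≺ f x) →
          Finite S (λ x → f x ≺ x) ⊎ Cofinite (λ x → f x ≺ x) → Drift f
  drift f (inj₂ up) _           = upward up
  drift f (inj₁ _)  (inj₂ down) = downward down
  drift f (inj₁ up) (inj₁ down) = level (⊆-finite (λ {x} → cover x) (∪-finite up down))
    where
    cover : ∀ x → ¬ (f x ∼ x) → x ≺ f x ⊎ f x ≺ x
    cover x not-∼ with decidable-stable em not-∼
    ... | inj₁ down = inj₂ down
    ... | inj₂ up   = inj₁ up

  -- Genericity is included so that cones and classes of regular points are under control.
  Regular : ∀ {f} → Drift f → Pred Carrier ℓ
  Regular {f} (upward _)   x = generic x × x ≺ f x
  Regular {f} (downward _) x = generic x × f x ≺ x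
  Regular {f} (level _)    x = generic x × f x ∼ x

  regular-cofinite : ∀ {f} (d : Drift f) → Cofinite (Regular d)
  regular-cofinite (upward fin)   = ∩-cofinite em generic-cofinite fin
  regular-cofinite (downward fin) = ∩-cofinite em generic-cofinite fin
  regular-cofinite (level fin)    = ∩-cofinite em generic-cofinite fin

-- Divisible groups with an almost weak order

even≢odd : ∀ {m n} → 2 ∣ m → 2 ∣ n → m ≢ n ℕ.+ 1
even≢odd {m} {n} 2∣m 2∣n ≡.refl with () ← ∣1⇒≡1 (∣m+n∣m⇒∣n 2∣m 2∣n)

distinct-primes-coprime : ∀ {p q} → Prime p → Prime q → p ≢ q → Coprime p q
distinct-primes-coprime p-prime q-prime p≢q (d∣p , d∣q)
  with prime⇒irreducible p-prime d∣p | prime⇒irreducible q-prime d∣q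
... | inj₁ d≡1 | _         = d≡1
... | inj₂ _   | inj₁ d≡1  = d≡1
... | inj₂ d≡p | inj₂ d≡q  = contradiction (≡.trans (≡.sym d≡p) d≡q) p≢q

module MultiplicationFibres (em : ∀ {a} → ExcludedMiddle a) (A : AbelianGroup ℓ ℓ) where
  open AbelianGroup A hiding (_-_)
  open AbelianGroupProperties A
  open Multiples A
  open FiniteSets setoid
  open SetoidReasoning setoid

  -- A nonempty fibre is a coset of the kernel.
  fibre-finite : ∀ n → Finite setoid (λ x → n · x ≈ ε) → ∀ y → Finite setoid (λ x → n · x ≈ y)
  fibre-finite n socle-finite y with em {P = ∃[ x ] n · x ≈ y}
  ... | no none = [] , λ x nx≈y → contradiction (x , nx≈y) none
  ... | yes (x₀ , nx₀≈y) = ⊆-finite (λ {x} nx≈y → x ∙ x₀ ⁻¹ , (begin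
            n · (x ∙ x₀ ⁻¹)        ≈⟨ ×-distrib-+ _ _ n ⟩
            n · x ∙ n · (x₀ ⁻¹)    ≈⟨ ∙-cong nx≈y (trans (·-⁻¹ n x₀) (⁻¹-cong nx₀≈y)) ⟩
            y ∙ y ⁻¹               ≈⟨ inverseʳ y ⟩
            ε                      ∎) , sym (//-rightDividesˡ x₀ x))
          (image-finite (_∙ x₀) ∙-congʳ socle-finite)

module OrderedDivisibleGroup
  (em : ∀ {a} → ExcludedMiddle a) (A : AbelianGroup ℓ ℓ) (order : AlmostWeakOrder (AbelianGroup.setoid A)) where
  open AbelianGroup A hiding (_-_)
  open AbelianGroupProperties A
  open Multiples A
  open AlmostWeakOrder order
  open FiniteSets setoid
  open OrderDichotomy em order
  open Eventually em setoid
  open MultiplicationFibres em A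
  open CommutativeSemigroupProperties commutativeSemigroup using (x∙yz≈y∙xz)
  open SetoidReasoning setoid

  module _
    (infinite : Infinite setoid (U {A = Carrier}))
    (divisible : ∀ {q} → Prime q → ∀ x → ∃[ y ] q · y ≈ x)
    (socle-finite : ∀ {q} → Prime q → Finite setoid (λ x → q · x ≈ ε))
    (translation-drift : ∀ g → Drift (g ∙_))
    (multiple-drift : ∀ n → Drift (n ·_))
    where

    module _ (g : Carrier) (free : ∀ {m n} → m < n → ¬ m · g ≈ n · g) where

      multiples-injective : ∀ {m n} → m · g ≈ n · g → m ≡ n
      multiples-injective {m} {n} eq with ℕ.<-cmp m n
      ... | tri< m<n _ _ = contradiction eq (free m<n)
      ... | tri≈ _ m≡n _ = m≡n
      ... | tri> _ _ n<m = contradiction (sym eq) (free n<m)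

      -- Cosets of the subgroup generated by `g`; a natural multiplier on each side replaces one
      -- integer multiplier.
      SameCoset : Carrier → Carrier → Set ℓ
      SameCoset x y = ∃[ m ] ∃[ n ] m · g ∙ x ≈ n · g ∙ y

      module _ where
        open Roots 2 (divisible prime[2]) g

        -- Two halvings of g in the same coset of ⟨g⟩ give, after clearing denominators, an even
        -- and an odd multiple of g which agree.
        roots-in-distinct-cosets : ∀ {i j} → i < j → ∀ a b → ¬ a · g ∙ root i ≈ b · g ∙ root j
        roots-in-distinct-cosets {i} {j} i<j a b eq = even≢odd
          (∣m∣n⇒∣m+n (∣m⇒∣m*n a (2∣2^ j (ℕ.≤-trans (ℕ.s≤s ℕ.z≤n) i<j))) (2∣2^ (j ℕ.∸ i) (ℕ.m<n⇒0<n∸m i<j)))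
          (∣m⇒∣m*n b (2∣2^ j (ℕ.≤-trans (ℕ.s≤s ℕ.z≤n) i<j)))
          (multiples-injective (begin
            (2 ^ j ℕ.* a ℕ.+ 2 ^ (j ℕ.∸ i)) · g        ≈⟨ ×-homo-+ g (2 ^ j ℕ.* a) (2 ^ (j ℕ.∸ i)) ⟩
            (2 ^ j ℕ.* a) · g ∙ (2 ^ (j ℕ.∸ i)) · g    ≈⟨ ∙-cong (×-assocˡ g (2 ^ j) a) (q^j·root-i (ℕ.<⇒≤ i<j)) ⟨
            (2 ^ j) · a · g ∙ (2 ^ j) · root i         ≈⟨ ×-distrib-+ _ _ (2 ^ j) ⟨
            (2 ^ j) · (a · g ∙ root i)                 ≈⟨ ×-congʳ (2 ^ j) eq ⟩
            (2 ^ j) · (b · g ∙ root j)                 ≈⟨ ×-distrib-+ _ _ (2 ^ j) ⟩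
            (2 ^ j) · b · g ∙ (2 ^ j) · root j
              ≈⟨ ∙-cong (×-assocˡ g (2 ^ j) b) (trans (q^k·root j) (sym (×-homo-1 g))) ⟩
            (2 ^ j ℕ.* b) · g ∙ 1 · g                  ≈⟨ ×-homo-+ g (2 ^ j ℕ.* b) 1 ⟨
            (2 ^ j ℕ.* b ℕ.+ 1) · g                    ∎))
          where
          2∣2^ : ∀ k → 0 < k → 2 ∣ 2 ^ k
          2∣2^ (suc k) _ = m∣m*n (2 ^ k)

        -- Were every coset to meet `P`, the pigeonhole principle would put two halvings of `g` into
        -- the coset of one point of `P`.
        coset-avoiding : {P : Pred Carrier ℓ} → Finite setoid P → ∃[ x ] ∀ y → P y → ¬ SameCoset x y
        coset-avoiding {P} P-fin = decidable-stable em λ none →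
          let hit : ∀ k → ∃[ y ] P y × SameCoset (root k) y
              hit k = decidable-stable em λ miss → none (root k , λ y Py same → miss (y , Py , same))
              i , j , i<j , yᵢ≈yⱼ = pigeonhole P-fin (λ k → proj₁ (hit k)) (λ k → proj₁ (proj₂ (hit k)))
              y  , _ , m  , n  , eq  = hit i
              y′ , _ , m′ , n′ , eq′ = hit j
          -- Adding `n′ · g` to the first coset equation and `n · g` to the second makes their
          -- right-hand sides equal.
          in roots-in-distinct-cosets i<j (n′ ℕ.+ m) (n ℕ.+ m′) (begin
            (n′ ℕ.+ m) · g ∙ root i      ≈⟨ ∙-congʳ (×-homo-+ g n′ m) ⟩
            n′ · g ∙ m · g ∙ root i      ≈⟨ assoc _ _ _ ⟩
            n′ · g ∙ (m · g ∙ root i)    ≈⟨ ∙-congˡ (trans eq (∙-congˡ yᵢ≈yⱼ)) ⟩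
            n′ · g ∙ (n · g ∙ y′)        ≈⟨ x∙yz≈y∙xz _ _ _ ⟩
            n · g ∙ (n′ · g ∙ y′)        ≈⟨ ∙-congˡ eq′ ⟨
            n · g ∙ (m′ · g ∙ root j)    ≈⟨ assoc _ _ _ ⟨
            n · g ∙ m′ · g ∙ root j      ≈⟨ ∙-congʳ (×-homo-+ g n m′) ⟨
            (n ℕ.+ m′) · g ∙ root j      ∎)

      module _ (x : Carrier) where
        forward backward : ℕ → Carrier
        forward zero     = x
        forward (suc n)  = g ∙ forward n
        backward zero    = x
        backward (suc n) = g ⁻¹ ∙ backward n

        forward≈ : ∀ n → forward n ≈ n · g ∙ x
        forward≈ zero    = sym (identityˡ x)
        forward≈ (suc n) = trans (∙-congˡ (forward≈ n)) (sym (assoc _ _ _))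

        g∙backward : ∀ n → g ∙ backward (suc n) ≈ backward n
        g∙backward n = \\-leftDividesˡ g (backward n)

        backward≈ : ∀ n → n · g ∙ backward n ≈ x
        backward≈ zero    = identityˡ x
        backward≈ (suc n) = begin
          g ∙ n · g ∙ backward (suc n)     ≈⟨ ∙-congʳ (comm _ _) ⟩
          n · g ∙ g ∙ backward (suc n)     ≈⟨ assoc _ _ _ ⟩
          n · g ∙ (g ∙ backward (suc n))   ≈⟨ ∙-congˡ (g∙backward n) ⟩
          n · g ∙ backward n               ≈⟨ backward≈ n ⟩
          x                                ∎

        forward-coset : ∀ n → SameCoset x (forward n)
        forward-coset n = n , 0 , trans (sym (forward≈ n)) (sym (identityˡ _))

        backward-coset : ∀ n → SameCoset x (backward n)
        backward-coset n = 0 , n , trans (identityˡ x) (sym (backward≈ n))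

      -- Unless the drift is level, one half of the orbit ascends from `x` and the other descends,
      -- so neither cone of `x` can be cofinite. Level drift makes the forward half repeat, against
      -- `free`.
      orbits-irregular : ∀ x (d : Drift (g ∙_)) →
                         (∀ n → Regular d (forward x n)) → (∀ n → Regular d (backward x n)) → ⊥
      orbits-irregular x (upward _) fwd bwd with cone-cofinite (proj₁ (fwd 0))
      ... | inj₁ below = ascending-not-below (forward x) (λ n → proj₂ (fwd n)) below
      ... | inj₂ above = descending-not-above (backward x)
              (λ n → <-respʳ-≈ (g∙backward x n) (proj₂ (bwd (suc n)))) above
      orbits-irregular x (downward _) fwd bwd with cone-cofinite (proj₁ (fwd 0))
      ... | inj₁ below = ascending-not-below (backward x)
              (λ n → <-respˡ-≈ (g∙backward x n) (proj₂ (bwd (suc n)))) below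
      ... | inj₂ above = descending-not-above (forward x) (λ n → proj₂ (fwd n)) above
      orbits-irregular x (level _) fwd bwd
        with i , j , i<j , fi≈fj ← constant-repeats (forward x) (proj₁ ∘ fwd) (proj₂ ∘ fwd)
        = free i<j (∙-cancelʳ x _ _ (trans (sym (forward≈ x i)) (trans fi≈fj (forward≈ x j))))

      not-free : ⊥
      not-free = escape (coset-avoiding (regular-cofinite d))
        where
        d : Drift (g ∙_)
        d = translation-drift g

        escape : (∃[ x ] ∀ y → ¬ Regular d y → ¬ SameCoset x y) → ⊥
        escape (x , avoids) = orbits-irregular x d
          (λ n → decidable-stable em λ ¬reg → avoids (forward x n) ¬reg (forward-coset x n))
          (λ n → decidable-stable em λ ¬reg → avoids (backward x n) ¬reg (backward-coset x n))

    torsion : ∀ g → ∃[ n ] 0 < n × n · g ≈ ε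
    torsion g = decidable-stable em λ free →
      not-free g λ m<n mg≈ng → free (·-≈⇒annihilated g m<n mg≈ng)

    -- Multiplication by `q` lowers the exponent by one and has finite fibres.
    torsion-power-finite : ∀ {q} → Prime q → ∀ k → Finite setoid (λ x → (q ^ k) · x ≈ ε)
    torsion-power-finite {q} q-prime zero    = ⊆-finite (λ {x} → trans (sym (×-homo-1 x))) (≈-finite ε)
    torsion-power-finite {q} q-prime (suc k) =
      ⊆-finite (λ {x} eq → trans (×-assocˡ x (q ^ k) q) (trans (×-congˡ (ℕ.*-comm (q ^ k) q)) eq))
        (preimage-finite (q ·_) (torsion-power-finite q-prime k) (fibre-finite q (socle-finite q-prime)))

    -- One factor is removed at a time: `(m ^ k) · x` is killed by both `m` and `n`.
    power-coprime-annihilators : ∀ {m n} → Coprime m n → ∀ k {x} → (m ^ k) · x ≈ ε → n · x ≈ ε → x ≈ ε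
    power-coprime-annihilators cop zero    {x} eq nx≈ε = trans (sym (×-homo-1 x)) eq
    power-coprime-annihilators {m} {n} cop (suc k) {x} eq nx≈ε = power-coprime-annihilators cop k
      (coprime-annihilators cop (trans (×-assocˡ x m (m ^ k)) eq)
        (trans (·-comm n (m ^ k) x) (trans (×-congʳ (m ^ k) nx≈ε) (·-ε (m ^ k))))) nx≈ε

    -- Multiplication by p has infinitely many finite orbits on r-torsion, so it cannot drift
    -- up or down; on a chain of p-th roots it moves, so it cannot stay level either.
    unique-prime : ∀ {p r} → Prime p → Prime r → p ≢ r →
                   ∀ {x y} → p · x ≈ ε → ¬ x ≈ ε → r · y ≈ ε → ¬ y ≈ ε → ⊥
    unique-prime {p} {r} p-prime r-prime p≢r {x} {y} px≈ε x≉ε ry≈ε y≉ε = orbit d regular-orbit regular-roots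
      where
      module X = Roots p (divisible p-prime) x
      module Y = Roots r (divisible r-prime) y

      d : Drift (p ·_)
      d = multiple-drift p

      -- A common point would make `p ^ j` annihilate `y`, whose order `r` is coprime to `p`.
      orbits-disjoint : ∀ {k l} → k < l → ∀ i j → ¬ (p ^ i) · Y.root k ≈ (p ^ j) · Y.root l
      orbits-disjoint k<l i j eq = y≉ε (power-coprime-annihilators
        (distinct-primes-coprime p-prime r-prime p≢r) j
        (Y.multiples-distinct ry≈ε (p ^ i) (p ^ j) k<l eq) ry≈ε)

      -- The orbits are pairwise disjoint, so finitely many irregular points cannot meet them all.
      regular-orbit : ∃[ k ] ∀ i → Regular d ((p ^ i) · Y.root k)
      regular-orbit = decidable-stable em λ none →
        let hit : ∀ k → ∃[ i ] ¬ Regular d ((p ^ i) · Y.root k)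
            hit k = decidable-stable em λ miss → none (k , λ i → decidable-stable em λ ¬reg → miss (i , ¬reg))
            k , l , k<l , eq =
              pigeonhole (regular-cofinite d) (λ k → (p ^ proj₁ (hit k)) · Y.root k) (λ k → proj₂ (hit k))
        in orbits-disjoint k<l (proj₁ (hit k)) (proj₁ (hit l)) eq

      X-distinct : ∀ {i j} → i < j → ¬ X.root i ≈ X.root j
      X-distinct i<j eq = x≉ε (trans (sym (×-homo-1 x))
        (X.multiples-distinct px≈ε 1 1 i<j (×-congʳ 1 eq)))

      regular-roots : ∃[ K ] ∀ k → K ≤ k → Regular d (X.root k)
      regular-roots =
        let K , outside = eventually-outside (regular-cofinite d) X.root X-distinct
        in K , λ k K≤k → decidable-stable em (outside k K≤k)

      orbit-finite : ∀ k i → (r ^ suc k) · ((p ^ i) · Y.root k) ≈ ε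
      orbit-finite k i = trans (·-comm (r ^ suc k) (p ^ i) _)
        (trans (×-congʳ (p ^ i) (Y.q^j·root-i≈ε ry≈ε (ℕ.n<1+n k))) (·-ε (p ^ i)))

      orbit : (d : Drift (p ·_)) → (∃[ k ] ∀ i → Regular d ((p ^ i) · Y.root k)) →
              (∃[ K ] ∀ k → K ≤ k → Regular d (X.root k)) → ⊥
      orbit (upward _) (k , reg) _ = ascending-infinite (λ i → (p ^ i) · Y.root k)
        (λ i → <-respʳ-≈ (×-assocˡ _ p (p ^ i)) (proj₂ (reg i)))
        (orbit-finite k) (torsion-power-finite r-prime (suc k))
      orbit (downward _) (k , reg) _ = descending-infinite (λ i → (p ^ i) · Y.root k)
        (λ i → <-respˡ-≈ (×-assocˡ _ p (p ^ i)) (proj₂ (reg i)))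
        (orbit-finite k) (torsion-power-finite r-prime (suc k))
      -- Read backwards along the roots of `x`, level drift says that consecutive roots are
      -- incomparable, so two of them coincide.
      orbit (level _) _ (K , reg)
        with i , j , i<j , eq ← constant-repeats (λ n → X.root (n ℕ.+ K))
               (λ n → proj₁ (reg (n ℕ.+ K) (ℕ.m≤n+m K n)))
               (λ n → ∼-respʳ (X.q·root (n ℕ.+ K)) (∼-sym (proj₂ (reg (suc n ℕ.+ K) (ℕ.m≤n+m K (suc n))))))
        = X-distinct (ℕ.+-monoˡ-< K i<j) eq

    -- Prime factors are dropped while the rest still annihilates `x`. The first that cannot be
    -- dropped annihilates the nonzero multiple of `x` by the rest.
    prime-order-multiple : ∀ {qs} → All Prime qs → ∀ {x} → product qs · x ≈ ε → ¬ x ≈ ε →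
                           ∃[ q ] Prime q × ∃[ y ] q · y ≈ ε × ¬ y ≈ ε
    prime-order-multiple []                       {x} eq x≉ε = contradiction (trans (sym (×-homo-1 x)) eq) x≉ε
    prime-order-multiple (_∷_ {q} {qs} q-prime prs) {x} eq x≉ε with em {P = product qs · x ≈ ε}
    ... | yes eq′ = prime-order-multiple prs eq′ x≉ε
    ... | no neq  = q , q-prime , product qs · x , trans (×-assocˡ x q (product qs)) eq , neq

    prime-annihilators : ∀ x → ∃[ qs ] All Prime qs × product qs · x ≈ ε
    prime-annihilators x = factors-annihilate (torsion x)
      where
      factors-annihilate : (∃[ n ] 0 < n × n · x ≈ ε) → ∃[ qs ] All Prime qs × product qs · x ≈ ε
      factors-annihilate (n@(suc _) , _ , eq) = factors , factorsPrime , trans (×-congˡ (≡.sym isFactorisation)) eq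
        where
        open PrimeFactorisation (factorise n)

    element-of-prime-order : ∃[ p ] Prime p × ∃[ x ] p · x ≈ ε × ¬ x ≈ ε
    element-of-prime-order =
      let x , x≉ε      = cofinite-inhabited em infinite (⊆-finite (decidable-stable em) (≈-finite ε))
          _ , prs , eq = prime-annihilators x
      in prime-order-multiple prs eq x≉ε

    -- A factor other than `p` can always be dropped: otherwise some multiple of `y` would be
    -- nonzero and killed by that prime, against `unique-prime`. The factors `p` are counted by `k`.
    primary : ∀ {p} → Prime p → ∀ {x} → p · x ≈ ε → ¬ x ≈ ε → ∀ y → ∃[ k ] (p ^ k) · y ≈ ε
    primary {p} p-prime px≈ε x≉ε y = let _ , prs , eq = prime-annihilators y in go prs y eq
      where
      go : ∀ {qs} → All Prime qs → ∀ y → product qs · y ≈ ε → ∃[ k ] (p ^ k) · y ≈ ε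
      go []                         y eq = 0 , eq
      go (_∷_ {q} {qs} q-prime prs) y eq with em {P = product qs · y ≈ ε} | p ℕ.≟ q
      ... | yes eq′ | _ = go prs y eq′
      ... | no neq | no p≢q = ⊥-elim (unique-prime p-prime q-prime p≢q px≈ε x≉ε
                                (trans (×-assocˡ y q (product qs)) eq) neq)
      ... | no neq | yes ≡.refl =
        let k , eq′ = go prs (p · y) (trans (·-comm (product qs) p y) (trans (×-assocˡ y p (product qs)) eq))
        in suc k , trans (sym (×-assocˡ y p (p ^ k))) (trans (·-comm p (p ^ k) y) eq′)

    isFiniteSumOfPrüferGroups : ∃[ p ] Prime p × IsFiniteSumOfPrüfer p group
    isFiniteSumOfPrüferGroups =
      let p , p-prime , x , px≈ε , x≉ε = element-of-prime-order
      in p , p-prime , PrüferGroup.isFiniteSumOfPrüfer p p-prime A em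
           (divisible p-prime) (socle-finite p-prime) (primary p-prime px≈ε x≉ε)

-- Reineke: minimal groups are abelian

parity : ∀ n → ∃[ k ] (n ≡ k ℕ.+ k ⊎ n ≡ suc (k ℕ.+ k))
parity zero    = 0 , inj₁ ≡.refl
parity (suc n) with parity n
... | k , inj₁ ≡.refl = k , inj₂ ≡.refl
... | k , inj₂ ≡.refl = suc k , inj₁ (≡.cong suc (≡.sym (ℕ.+-suc k k)))

module InfiniteGroup (em : ∀ {a} → ExcludedMiddle a) (G : Group ℓ ℓ)
                     (infinite : Infinite (Group.setoid G) (U {A = Group.Carrier G})) where
  open Group G hiding (_-_)
  open GroupProperties G
  open FiniteSets setoid

  finite⇒¬cofinite : {P : Pred Carrier a} → Finite setoid P → ¬ Cofinite P
  finite⇒¬cofinite {P = P} fin cof = infinite (⊆-finite (λ {x} _ → cover x) (∪-finite fin cof))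
    where
    cover : ∀ x → P x ⊎ ¬ P x
    cover x with em {P = P x}
    ... | yes Px = inj₁ Px
    ... | no ¬Px = inj₂ ¬Px

  -- A cofinite set P meets its translates, so every x is a quotient of two elements of P.
  cofinite-subgroup-full : {P : Pred Carrier a} → (∀ x y → P (x ∙ y) → P y → P x) → Cofinite P → ∀ x → P x
  cofinite-subgroup-full {P = P} quotient cof x =
    let y , Py , Pxy = cofinite-inhabited em infinite (∩-cofinite em cof translate) in quotient x y Pxy Py
    where
    translate : Cofinite (λ y → P (x ∙ y))
    translate = preimage-finite (x ∙_) cof λ z → ⊆-finite (λ {y} xy≈z → y≈x\\z x y z xy≈z) (≈-finite (x ⁻¹ ∙ z))

-- Commutation and conjugacy in an arbitrary group

module Centralisers (G : Group ℓ ℓ) where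
  open Group G hiding (_-_)
  open GroupProperties G
  open GroupMultiples G
  open SetoidReasoning setoid

  Commutes : Carrier → Pred Carrier ℓ
  Commutes y x = x ∙ y ≈ y ∙ x

  Central : Pred Carrier ℓ
  Central x = ∀ y → Commutes y x

  -- Stated without inverses, which are not in the language.
  Conjugate : Carrier → Pred Carrier ℓ
  Conjugate x y = ∃[ g ] g ∙ x ≈ y ∙ g

  commutes-resp : ∀ {a x y} → x ≈ y → Commutes a x → Commutes a y
  commutes-resp x≈y xa = trans (∙-congʳ (sym x≈y)) (trans xa (∙-congˡ x≈y))

  commutes-∙ : ∀ {a x y} → Commutes a x → Commutes a y → Commutes a (x ∙ y)
  commutes-∙ {a} {x} {y} xa ya = begin
    x ∙ y ∙ a      ≈⟨ assoc x y a ⟩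
    x ∙ (y ∙ a)    ≈⟨ ∙-congˡ ya ⟩
    x ∙ (a ∙ y)    ≈⟨ assoc x a y ⟨
    x ∙ a ∙ y      ≈⟨ ∙-congʳ xa ⟩
    a ∙ x ∙ y      ≈⟨ assoc a x y ⟩
    a ∙ (x ∙ y)    ∎

  -- In the quotient form that `cofinite-subgroup-full` takes.
  commutes-/ : ∀ {a} x y → Commutes a (x ∙ y) → Commutes a y → Commutes a x
  commutes-/ {a} x y xya ya = ∙-cancelʳ y _ _ (begin
    x ∙ a ∙ y      ≈⟨ assoc x a y ⟩
    x ∙ (a ∙ y)    ≈⟨ ∙-congˡ ya ⟨
    x ∙ (y ∙ a)    ≈⟨ assoc x y a ⟨
    x ∙ y ∙ a      ≈⟨ xya ⟩
    a ∙ (x ∙ y)    ≈⟨ assoc a x y ⟨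
    a ∙ x ∙ y      ∎)

  commutes-ε : ∀ {a} → Commutes a ε
  commutes-ε = trans (identityˡ _) (sym (identityʳ _))

  commutes-· : ∀ {a x} n → Commutes a x → Commutes a (n · x)
  commutes-· zero    xa = commutes-ε
  commutes-· (suc n) xa = commutes-∙ xa (commutes-· n xa)

  central-∙ : ∀ {x y} → Central x → Central y → Central (x ∙ y)
  central-∙ zx zy a = commutes-∙ (zx a) (zy a)

  central-resp : ∀ {x y} → x ≈ y → Central x → Central y
  central-resp x≈y zx a = commutes-resp x≈y (zx a)

  central-⁻¹ : ∀ {x} → Central (x ⁻¹) → Central x
  central-⁻¹ {x} zx⁻¹ a = commutes-/ x (x ⁻¹) (commutes-resp (sym (inverseʳ x)) commutes-ε) (zx⁻¹ a)

  conjugate-sym : ∀ {x y} → Conjugate x y → Conjugate y x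
  conjugate-sym {x} {y} (g , gx≈yg) = g ⁻¹ , ∙-cancelˡ g _ _ (begin
    g ∙ (g ⁻¹ ∙ y)       ≈⟨ \\-leftDividesˡ g y ⟩
    y                    ≈⟨ //-rightDividesʳ g y ⟨
    y ∙ g ∙ g ⁻¹         ≈⟨ ∙-congʳ gx≈yg ⟨
    g ∙ x ∙ g ⁻¹         ≈⟨ assoc g x (g ⁻¹) ⟩
    g ∙ (x ∙ g ⁻¹)       ∎)

  conjugate-trans : ∀ {x y z} → Conjugate x y → Conjugate y z → Conjugate x z
  conjugate-trans {x} {y} {z} (g , gx≈yg) (h , hy≈zh) = h ∙ g , (begin
    h ∙ g ∙ x      ≈⟨ assoc h g x ⟩
    h ∙ (g ∙ x)    ≈⟨ ∙-congˡ gx≈yg ⟩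
    h ∙ (y ∙ g)    ≈⟨ assoc h y g ⟨
    h ∙ y ∙ g      ≈⟨ ∙-congʳ hy≈zh ⟩
    z ∙ h ∙ g      ≈⟨ assoc z h g ⟩
    z ∙ (h ∙ g)    ∎)

  conjugate-square : ∀ {x y} → Conjugate x y → Conjugate (x ∙ x) (y ∙ y)
  conjugate-square {x} {y} (g , gx≈yg) = g , (begin
    g ∙ (x ∙ x)    ≈⟨ assoc g x x ⟨
    g ∙ x ∙ x      ≈⟨ ∙-congʳ gx≈yg ⟩
    y ∙ g ∙ x      ≈⟨ assoc y g x ⟩
    y ∙ (g ∙ x)    ≈⟨ ∙-congˡ gx≈yg ⟩
    y ∙ (y ∙ g)    ≈⟨ assoc y y g ⟨
    y ∙ y ∙ g      ∎)

  conjugate-central : ∀ {x y} → Conjugate x y → Central x → Central y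
  conjugate-central {x} {y} (g , gx≈yg) zx = central-resp (∙-cancelʳ g _ _ (trans (zx g) gx≈yg)) zx

  -- g a g⁻¹ a⁻¹ = (g a)² (g⁻¹)² (a⁻¹)² once squares are central.
  squares-central⇒commutators-central : (∀ x → Central (x ∙ x)) →
    ∀ {g a y} → g ∙ a ≈ y ∙ g → Central (y ∙ a ⁻¹)
  squares-central⇒commutators-central squares {g} {a} {y} ga≈yg = central-resp (begin
    (g ∙ a) ∙ (g ∙ a) ∙ (s ∙ t)       ≈⟨ ∙-congʳ (assoc (g ∙ a) g a) ⟨
    g ∙ a ∙ g ∙ a ∙ (s ∙ t)           ≈⟨ assoc (g ∙ a ∙ g) a (s ∙ t) ⟩
    g ∙ a ∙ g ∙ (a ∙ (s ∙ t))         ≈⟨ ∙-congˡ (begin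
        a ∙ (s ∙ t)          ≈⟨ assoc a s t ⟨
        a ∙ s ∙ t            ≈⟨ ∙-congʳ (squares (g ⁻¹) a) ⟨
        s ∙ a ∙ t            ≈⟨ assoc s a t ⟩
        s ∙ (a ∙ t)          ≈⟨ ∙-congˡ (\\-leftDividesˡ a (a ⁻¹)) ⟩
        s ∙ a ⁻¹             ≈⟨ assoc _ _ _ ⟩
        g ⁻¹ ∙ (g ⁻¹ ∙ a ⁻¹) ∎) ⟩
    g ∙ a ∙ g ∙ (g ⁻¹ ∙ (g ⁻¹ ∙ a ⁻¹)) ≈⟨ assoc (g ∙ a) g _ ⟩
    g ∙ a ∙ (g ∙ (g ⁻¹ ∙ (g ⁻¹ ∙ a ⁻¹))) ≈⟨ ∙-cong ga≈yg (\\-leftDividesˡ g _) ⟩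
    y ∙ g ∙ (g ⁻¹ ∙ a ⁻¹)             ≈⟨ assoc y g _ ⟩
    y ∙ (g ∙ (g ⁻¹ ∙ a ⁻¹))           ≈⟨ ∙-congˡ (\\-leftDividesˡ g _) ⟩
    y ∙ a ⁻¹                          ∎)
    (central-∙ (squares (g ∙ a)) (central-∙ (squares (g ⁻¹)) (squares (a ⁻¹))))
    where
    s = g ⁻¹ ∙ g ⁻¹
    t = a ⁻¹ ∙ a ⁻¹

  -- Conjugation by `g` inverts `a`, so doing it twice fixes `a`.
  inverted⇒square-commutes : ∀ {g a} → g ∙ a ≈ a ⁻¹ ∙ g → Commutes a (g ∙ g)
  inverted⇒square-commutes {g} {a} ga≈a⁻¹g = begin
    g ∙ g ∙ a             ≈⟨ assoc g g a ⟩
    g ∙ (g ∙ a)           ≈⟨ ∙-congˡ ga≈a⁻¹g ⟩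
    g ∙ (a ⁻¹ ∙ g)        ≈⟨ \\-leftDividesˡ a _ ⟨
    a ∙ (a ⁻¹ ∙ (g ∙ (a ⁻¹ ∙ g)))  ≈⟨ ∙-congˡ (assoc (a ⁻¹) g _) ⟨
    a ∙ (a ⁻¹ ∙ g ∙ (a ⁻¹ ∙ g))    ≈⟨ ∙-congˡ (∙-congʳ ga≈a⁻¹g) ⟨
    a ∙ (g ∙ a ∙ (a ⁻¹ ∙ g))       ≈⟨ ∙-congˡ (assoc g a _) ⟩
    a ∙ (g ∙ (a ∙ (a ⁻¹ ∙ g)))     ≈⟨ ∙-congˡ (∙-congˡ (\\-leftDividesˡ a g)) ⟩
    a ∙ (g ∙ g)           ∎

module MinimalGroupsAbelian (em : ∀ {a} → ExcludedMiddle a) (G : Group ℓ ℓ) where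
  open Group G hiding (_-_)
  open GroupProperties G
  open GroupMultiples G
  open Centralisers G
  open FiniteSets setoid
  open SetoidReasoning setoid

  module _
    (infinite : Infinite setoid (U {A = Carrier}))
    (centraliser-minimal : ∀ a → Finite setoid (Commutes a) ⊎ Cofinite (Commutes a))
    (centre-minimal : Finite setoid Central ⊎ Cofinite Central)
    (class-minimal : ∀ a → Finite setoid (Conjugate a) ⊎ Cofinite (Conjugate a))
    where
    open InfiniteGroup em G infinite

    -- A cofinite centraliser would be the whole group.
    centraliser-finite : ∀ {a} → ¬ Central a → Finite setoid (Commutes a)
    centraliser-finite {a} a∉Z with centraliser-minimal a
    ... | inj₁ fin = fin
    ... | inj₂ cof = contradiction (λ y → sym (cofinite-subgroup-full commutes-/ cof y)) a∉Z

    -- The fibres of `g ↦ g a g⁻¹` are cosets of the finite centraliser of `a`, so a finite class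
    -- would make the group finite.
    class-cofinite : ∀ {a} → ¬ Central a → Cofinite (Conjugate a)
    class-cofinite {a} a∉Z with class-minimal a
    ... | inj₂ cof = cof
    ... | inj₁ fin = contradiction
          (⊆-finite (λ {g} _ → g , sym (//-rightDividesˡ g (g ∙ a)))
            (preimage-finite (λ g → g ∙ a ∙ g ⁻¹) fin fibre-finite)) infinite
      where
      fibre-finite : ∀ z → Finite setoid (λ g → g ∙ a ∙ g ⁻¹ ≈ z)
      fibre-finite z with em {P = ∃[ g ] g ∙ a ∙ g ⁻¹ ≈ z}
      ... | no none = [] , λ g eq → contradiction (g , eq) none
      ... | yes (h , hah⁻¹≈z) = ⊆-finite
            (λ {g} gag⁻¹≈z → h ⁻¹ ∙ g , coset gag⁻¹≈z , sym (\\-leftDividesˡ h g))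
            (image-finite (h ∙_) ∙-congˡ (centraliser-finite a∉Z))
        where
        coset : ∀ {g} → g ∙ a ∙ g ⁻¹ ≈ z → Commutes a (h ⁻¹ ∙ g)
        coset {g} gag⁻¹≈z = begin
          h ⁻¹ ∙ g ∙ a           ≈⟨ assoc _ _ _ ⟩
          h ⁻¹ ∙ (g ∙ a)         ≈⟨ ∙-congˡ (//-rightDividesˡ g (g ∙ a)) ⟨
          h ⁻¹ ∙ (g ∙ a ∙ g ⁻¹ ∙ g) ≈⟨ ∙-congˡ (∙-congʳ (trans gag⁻¹≈z (sym hah⁻¹≈z))) ⟩
          h ⁻¹ ∙ (h ∙ a ∙ h ⁻¹ ∙ g) ≈⟨ ∙-congˡ (assoc _ _ _) ⟩
          h ⁻¹ ∙ (h ∙ a ∙ (h ⁻¹ ∙ g)) ≈⟨ ∙-congˡ (assoc _ _ _) ⟩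
          h ⁻¹ ∙ (h ∙ (a ∙ (h ⁻¹ ∙ g))) ≈⟨ \\-leftDividesʳ h _ ⟩
          a ∙ (h ⁻¹ ∙ g)         ∎

    -- Two cofinite classes in an infinite group meet.
    noncentral-conjugate : ∀ {x y} → ¬ Central x → ¬ Central y → Conjugate x y
    noncentral-conjugate x∉Z y∉Z =
      let z , xz , yz = cofinite-inhabited em infinite (∩-cofinite em (class-cofinite x∉Z) (class-cofinite y∉Z))
      in conjugate-trans xz (conjugate-sym yz)

    -- All powers of `x` lie in its finite centraliser.
    noncentral-torsion : ∀ {x} → ¬ Central x → ∃[ n ] 0 < n × n · x ≈ ε
    noncentral-torsion {x} x∉Z =
      let i , j , i<j , eq = pigeonhole (centraliser-finite x∉Z) (_· x) (λ n → commutes-· n refl)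
      in ·-≈⇒annihilated x i<j eq

    module _ {a} (a∉Z : ¬ Central a) where

      centre-finite : Finite setoid Central
      centre-finite = [ id , (λ cof → contradiction
        (cofinite-subgroup-full (λ x y zxy zy b → commutes-/ x y (zxy b) (zy b)) cof a) a∉Z) ] centre-minimal

      -- Otherwise the class of `a` would lie in the coset of the finite centre through `a`, but it
      -- is cofinite.
      squares-not-all-central : ¬ (∀ x → Central (x ∙ x))
      squares-not-all-central squares = finite⇒¬cofinite
        (⊆-finite (λ {y} (g , ga≈yg) → y ∙ a ⁻¹ , squares-central⇒commutators-central squares ga≈yg
                                     , sym (//-rightDividesˡ a y))
          (image-finite (_∙ a) ∙-congʳ centre-finite))
        (class-cofinite a∉Z)

      -- All noncentral elements are conjugate, so one central square of a noncentral element would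
      -- make every square central.
      square-noncentral : ∀ {x} → ¬ Central x → ¬ Central (x ∙ x)
      square-noncentral {x} x∉Z x²∈Z = squares-not-all-central squares
        where
        squares : ∀ y → Central (y ∙ y)
        squares y with em {P = Central y}
        ... | yes y∈Z = central-∙ y∈Z y∈Z
        ... | no y∉Z  = conjugate-central (conjugate-square (noncentral-conjugate x∉Z y∉Z)) x²∈Z

      -- An even exponent can be halved, because by `square-noncentral` an element with central
      -- square is central.
      odd-power-central : ∀ {g} n → 0 < n → Central (n · g) → ∃[ m ] Central (suc (m ℕ.+ m) · g)
      odd-power-central {g} = <-rec _ λ n rec 0<n ng∈Z → step n rec 0<n ng∈Z (parity n)
        where
        step : ∀ n → (∀ {k} → k < n → 0 < k → Central (k · g) → ∃[ m ] Central (suc (m ℕ.+ m) · g)) →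
               0 < n → Central (n · g) → ∃[ k ] (n ≡ k ℕ.+ k ⊎ n ≡ suc (k ℕ.+ k)) →
               ∃[ m ] Central (suc (m ℕ.+ m) · g)
        step n rec 0<n ng∈Z (m , inj₂ ≡.refl)     = m , ng∈Z
        step n rec ()  ng∈Z (zero , inj₁ ≡.refl)
        step n rec 0<n ng∈Z (k@(suc _) , inj₁ ≡.refl) =
          rec {k} (ℕ.m<m+n k (ℕ.s≤s ℕ.z≤n)) (ℕ.s≤s ℕ.z≤n) (decidable-stable em λ kg∉Z →
            square-noncentral kg∉Z (central-resp (×-homo-+ g k k) ng∈Z))

      -- The conjugator g of a to a⁻¹ satisfies [g², a] = 1, and an odd power of g is central.
      nonabelian-impossible : ⊥
      nonabelian-impossible =
        let g , ga≈a⁻¹g = noncentral-conjugate a∉Z (a∉Z ∘ central-⁻¹)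
            not-commute : ¬ Commutes a g
            -- Commuting would give `a ≈ a ⁻¹`, so that the square of `a` would be trivial and hence
            -- central.
            not-commute ga≈ag = square-noncentral a∉Z (central-resp
              (trans (sym (inverseʳ a)) (∙-congˡ (sym (∙-cancelʳ g _ _ (trans (sym ga≈ag) ga≈a⁻¹g)))))
              (λ _ → commutes-ε))
            g∉Z : ¬ Central g
            g∉Z g∈Z = not-commute (g∈Z a)
            n , 0<n , ng≈ε = noncentral-torsion g∉Z
            m , odd = odd-power-central {g} n 0<n (central-resp (sym ng≈ε) (λ _ → commutes-ε))
            m·g²-commutes = commutes-· m (inverted⇒square-commutes ga≈a⁻¹g)
        -- Here `g` is the quotient of its central odd power by a power of its square, and both
        -- commute with `a`.
        in not-commute (commutes-/ g ((m ℕ.+ m) · g) (odd a) (commutes-resp (begin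
             m · (g ∙ g)          ≈⟨ ×-congʳ m (∙-congˡ (identityʳ g)) ⟨
             m · (2 · g)          ≈⟨ ×-assocˡ g m 2 ⟩
             (m ℕ.* 2) · g        ≈⟨ ×-congˡ (≡.trans (ℕ.*-comm m 2) (≡.cong (m ℕ.+_) (ℕ.+-identityʳ m))) ⟩
             (m ℕ.+ m) · g        ∎) m·g²-commutes))

    commutative : Commutative _≈_ _∙_
    commutative x y = decidable-stable em λ xy≉yx → nonabelian-impossible (λ x∈Z → xy≉yx (x∈Z y))

-- Renaming variables

module _ {L : Language ℓ} where

  mutual
    renᵗ : (Fin n → Fin n′) → Term L n → Term L n′
    renᵗ f (var i)    = var (f i)
    renᵗ f (app g ts) = app g (renᵗˢ f ts)

    renᵗˢ : (Fin n → Fin n′) → Vec (Term L n) k → Vec (Term L n′) k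
    renᵗˢ f []       = []
    renᵗˢ f (t ∷ ts) = renᵗ f t ∷ renᵗˢ f ts

  ren : (Fin n → Fin n′) → Formula L n → Formula L n′
  ren f ⊥̇          = ⊥̇
  ren f (s ≈̇ t)    = renᵗ f s ≈̇ renᵗ f t
  ren f (rel R ts) = rel R (renᵗˢ f ts)
  ren f (φ ∧̇ ψ)    = ren f φ ∧̇ ren f ψ
  ren f (φ ∨̇ ψ)    = ren f φ ∨̇ ren f ψ
  ren f (φ ⇒̇ ψ)    = ren f φ ⇒̇ ren f ψ
  ren f (∀̇ φ)      = ∀̇ ren (Fin.lift 1 f) φ
  ren f (∃̇ φ)      = ∃̇ ren (Fin.lift 1 f) φ

  distinctFrom : (Fin k → Fin n) → Formula L (suc n)
  distinctFrom {k = zero}  f = ⊥̇ ⇒̇ ⊥̇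
  distinctFrom {k = suc k} f = (var zero ≈̇ var (suc (f zero)) ⇒̇ ⊥̇) ∧̇ distinctFrom (f ∘ suc)

  module _ (M : Structure L m) where
    open Structure M using (Carrier; _≈_; ⟦_⟧ᶠ; ⟦_⟧ʳ; reflexive; trans)

    Renames : (Fin n → Fin n′) → Vec Carrier n′ → Vec Carrier n → Set m
    Renames f ρ ρ′ = ∀ i → lookup ρ (f i) ≡ lookup ρ′ i

    lift-renames : ∀ {f : Fin n → Fin n′} {ρ ρ′} → Renames f ρ ρ′ → ∀ x → Renames (Fin.lift 1 f) (x ∷ ρ) (x ∷ ρ′)
    lift-renames eq x zero    = ≡.refl
    lift-renames eq x (suc i) = eq i

    mutual
      eval-ren : ∀ {f : Fin n → Fin n′} {ρ ρ′} → Renames f ρ ρ′ → ∀ t → eval M ρ (renᵗ f t) ≡ eval M ρ′ t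
      eval-ren eq (var i)    = eq i
      eval-ren eq (app g ts) = ≡.cong ⟦ g ⟧ᶠ (evals-ren eq ts)

      evals-ren : ∀ {f : Fin n → Fin n′} {ρ ρ′} → Renames f ρ ρ′ → (ts : Vec (Term L n) k) →
                  evals M ρ (renᵗˢ f ts) ≡ evals M ρ′ ts
      evals-ren eq []       = ≡.refl
      evals-ren eq (t ∷ ts) = ≡.cong₂ _∷_ (eval-ren eq t) (evals-ren eq ts)

    infix 2 _⊩_
    private
      _⊩_ : Vec Carrier n → Formula L n → Set m
      ρ ⊩ φ = _⊨_ M ρ φ

    mutual
      -- Implication is contravariant on the left, so the two directions need each other.
      ⊨-ren⁻ : ∀ {f : Fin n → Fin n′} {ρ ρ′} → Renames f ρ ρ′ → ∀ φ → ρ ⊩ ren f φ → ρ′ ⊩ φ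
      ⊨-ren⁻ eq (s ≈̇ t)    h        = ≡.subst₂ _≈_ (eval-ren eq s) (eval-ren eq t) h
      ⊨-ren⁻ eq (rel R ts) h        = ≡.subst ⟦ R ⟧ʳ (evals-ren eq ts) h
      ⊨-ren⁻ eq (φ ∧̇ ψ)    (h , h′) = ⊨-ren⁻ eq φ h , ⊨-ren⁻ eq ψ h′
      ⊨-ren⁻ eq (φ ∨̇ ψ)    h        = Sum.map (⊨-ren⁻ eq φ) (⊨-ren⁻ eq ψ) h
      ⊨-ren⁻ eq (φ ⇒̇ ψ)    h        = ⊨-ren⁻ eq ψ ∘ h ∘ ⊨-ren⁺ eq φ
      ⊨-ren⁻ eq (∀̇ φ)      h        = λ x → ⊨-ren⁻ (lift-renames eq x) φ (h x)
      ⊨-ren⁻ eq (∃̇ φ)      (x , h)  = x , ⊨-ren⁻ (lift-renames eq x) φ h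

      ⊨-ren⁺ : ∀ {f : Fin n → Fin n′} {ρ ρ′} → Renames f ρ ρ′ → ∀ φ → ρ′ ⊩ φ → ρ ⊩ ren f φ
      ⊨-ren⁺ eq (s ≈̇ t)    h        = ≡.subst₂ _≈_ (≡.sym (eval-ren eq s)) (≡.sym (eval-ren eq t)) h
      ⊨-ren⁺ eq (rel R ts) h        = ≡.subst ⟦ R ⟧ʳ (≡.sym (evals-ren eq ts)) h
      ⊨-ren⁺ eq (φ ∧̇ ψ)    (h , h′) = ⊨-ren⁺ eq φ h , ⊨-ren⁺ eq ψ h′
      ⊨-ren⁺ eq (φ ∨̇ ψ)    h        = Sum.map (⊨-ren⁺ eq φ) (⊨-ren⁺ eq ψ) h
      ⊨-ren⁺ eq (φ ⇒̇ ψ)    h        = ⊨-ren⁺ eq ψ ∘ h ∘ ⊨-ren⁻ eq φ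
      ⊨-ren⁺ eq (∀̇ φ)      h        = λ x → ⊨-ren⁺ (lift-renames eq x) φ (h x)
      ⊨-ren⁺ eq (∃̇ φ)      (x , h)  = x , ⊨-ren⁺ (lift-renames eq x) φ h

    distinctFrom⁺ : (f : Fin k → Fin n) {ρ : Vec Carrier n} {x : Carrier} →
                    (∀ i → ¬ x ≈ lookup ρ (f i)) → x ∷ ρ ⊩ distinctFrom f
    distinctFrom⁺ {k = zero}  f new = id
    distinctFrom⁺ {k = suc k} f new = lift ∘ new zero , distinctFrom⁺ (f ∘ suc) (new ∘ suc)

    distinctFrom⁻ : (f : Fin k → Fin n) {ρ : Vec Carrier n} {x : Carrier} →
                    x ∷ ρ ⊩ distinctFrom f → ∀ i → ¬ x ≈ lookup ρ (f i)
    distinctFrom⁻ f (new , _)   zero    = lower ∘ new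
    distinctFrom⁻ f (_ , rest)  (suc i) = distinctFrom⁻ (f ∘ suc) rest i

    New : Vec Carrier n → Carrier → Set m
    New es x = ∀ i → ¬ x ≈ lookup es i

    new⁻ : (ps : Vec Carrier k) (es : Vec Carrier n) {x : Carrier} →
           x ∷ (ps ++ es) ⊩ distinctFrom (k ↑ʳ_) → New es x
    new⁻ ps es d i x≈eᵢ = distinctFrom⁻ (_ ↑ʳ_) d i (trans x≈eᵢ (reflexive (≡.sym (lookup-++ʳ ps es i))))

    new⁺ : (ps : Vec Carrier k) (es : Vec Carrier n) {x : Carrier} →
           New es x → x ∷ (ps ++ es) ⊩ distinctFrom (k ↑ʳ_)
    new⁺ ps es new = distinctFrom⁺ (_ ↑ʳ_) λ i x≈eᵢ → new i (trans x≈eᵢ (reflexive (lookup-++ʳ ps es i)))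

-- Realising the generic type

module GenericRealisations
  (em : ∀ {a} → ExcludedMiddle a) {L : Language ℓ} (M : Structure L ℓ) (min : IsMinimal M)
  (𝕄 : Monster M) (p : GenericType M) where
  open Structure M using (Carrier; setoid)
  open Monster 𝕄
  open GenericType p
  module N = Structure M̄

  private
    infix 2 _⊨ᴹ_ _⊨ᴺ_
    _⊨ᴹ_ : ∀ {n} → Vec Carrier n → Formula L n → Set _
    _⊨ᴹ_ = _⊨_ M
    _⊨ᴺ_ : ∀ {n} → Vec N.Carrier n → Formula L n → Set _
    _⊨ᴺ_ = _⊨_ M̄

  _⊑_ : ∀ {A : Set a} {m m′} → Vec A m → Vec A m′ → Set _
  xs ⊑ ys = Σ[ f ∈ (Fin _ → Fin _) ] ∀ i → lookup xs i ≡ lookup ys (f i)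

  ⊑-map : ∀ {m m′} {es : Vec Carrier m} {es′ : Vec Carrier m′} → es ⊑ es′ → map embed es ⊑ map embed es′
  ⊑-map {es = es} {es′} (f , eq) = f , λ i →
    ≡.trans (lookup-map i embed es) (≡.trans (≡.cong embed (eq i)) (≡.sym (lookup-map (f i) embed es′)))

  ++-⊑ˡ : ∀ {m m′} (es : Vec Carrier m) (es′ : Vec Carrier m′) → es ⊑ (es ++ es′)
  ++-⊑ˡ es es′ = (_↑ˡ _) , λ i → ≡.sym (lookup-++ˡ es es′ i)

  ++-⊑ʳ : ∀ {m m′} (es : Vec Carrier m) (es′ : Vec Carrier m′) → es′ ⊑ (es ++ es′)
  ++-⊑ʳ es es′ = (_ ↑ʳ_) , λ i → ≡.sym (lookup-++ʳ es es′ i)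

  -- A formula ψ m speaks about k points and about m excluded elements.
  Family : ℕ → Set ℓ
  Family k = ∀ m → Formula L (k ℕ.+ m)

  -- The new point avoids the `m` excluded elements, but may equal one of the `k` points already
  -- present.
  ∃̇-new : ∀ {k} → Family (suc k) → Family k
  ∃̇-new {k} ψ m = ∃̇ (distinctFrom (k ↑ʳ_) ∧̇ ψ m)

  -- Excluding more elements is the stronger demand, so finitely many demands can be merged by
  -- joining their exclusions.
  Antitone : ∀ {k} → Family k → Set _
  Antitone {k} ψ = ∀ (ps : Vec N.Carrier k) {m m′} {es : Vec N.Carrier m} {es′ : Vec N.Carrier m′} →
                   es ⊑ es′ → ps ++ es′ ⊨ᴺ ψ m′ → ps ++ es ⊨ᴺ ψ m

  new-⊑ : ∀ {m m′} (es : Vec N.Carrier m) (es′ : Vec N.Carrier m′) {x} → es ⊑ es′ → New M̄ es′ x → New M̄ es x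
  new-⊑ es es′ (f , eq) new i x≈eᵢ = new (f i) (N.trans x≈eᵢ (N.reflexive (eq i)))

  ∃̇-new-antitone : ∀ {k} {ψ : Family (suc k)} → Antitone ψ → Antitone (∃̇-new ψ)
  ∃̇-new-antitone anti ps {es = es} {es′} es⊑es′ (x , d , h) =
    x , new⁺ M̄ ps es (new-⊑ es es′ es⊑es′ (new⁻ M̄ ps es′ d)) , anti (x ∷ ps) es⊑es′ h

  -- By minimality a formula of the generic type fails in the small structure at finitely many
  -- elements only. With these as parameters that fact is first-order, and passes to the monster.
  generic-excludes : ∀ {n} (φ : Formula L (suc n)) (as : Vec Carrier n) → type (n , φ , as) →
                     ∃[ m ] Σ[ es ∈ Vec Carrier m ] ∀ x → New M̄ (map embed es) x → x ∷ map embed as ⊨ᴺ φ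
  generic-excludes {n} φ as φ∈p with IsMinimal.minimal min (n , φ , as)
  ... | inj₁ fin = contradiction fin (isNonAlgebraic _ φ∈p)
  ... | inj₂ (xs , exceptions) = List.length xs , es , λ x new →
        ⊨-ren⁻ M̄ (λ i → lookup-++ˡ (x ∷ map embed as) (map embed es) i) φ
          (transferred x (new⁺ M̄ (map embed as) (map embed es) new))
    where
    es = fromList xs

    lookup-es : ∀ {x} → Membership._∈_ setoid x xs → ∃[ i ] Structure._≈_ M x (lookup es i)
    lookup-es = go xs
      where
      go : ∀ xs {x} → Membership._∈_ setoid x xs → ∃[ i ] Structure._≈_ M x (lookup (fromList xs) i)
      go (y ∷ xs) (Any.here x≈y) = zero , x≈y
      go (y ∷ xs) (Any.there x∈) = let i , eq = go xs x∈ in suc i , eq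

    φ-outside : Formula L (n ℕ.+ List.length xs)
    φ-outside = ∀̇ (distinctFrom (n ↑ʳ_) ⇒̇ ren (_↑ˡ List.length xs) φ)

    true : as ++ es ⊨ᴹ φ-outside
    true x d = ⊨-ren⁺ M (λ i → lookup-++ˡ (x ∷ as) es i) φ (decidable-stable em λ ¬φ →
      let i , x≈eᵢ = lookup-es (exceptions x (¬φ ∘ ≡.subst (λ bs → x ∷ bs ⊨ᴹ φ) (map-id as)))
      in new⁻ M as es d i x≈eᵢ)

    transferred : map embed as ++ map embed es ⊨ᴺ φ-outside
    transferred = ≡.subst (_⊨ᴺ φ-outside) (map-++ embed as es)
      (Equivalence.to (elementary φ-outside (as ++ es)) true)

  module _ {k} {ψ : Family (suc k)} (anti : Antitone ψ) (ps : Vec N.Carrier k)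
           (satisfiable : ∀ m (es : Vec Carrier m) → ps ++ map embed es ⊨ᴺ ∃̇-new ψ m) where

    private
      -- Saturation asks for parameters indexed by a type in `Set ℓ`. The earlier points live one
      -- universe higher, so their positions name them.
      Name : Set ℓ
      Name = Lift ℓ (Fin k) ⊎ Carrier

      ι : Name → N.Carrier
      ι = [ lookup ps ∘ lower , embed ]

      names : Vec Name k
      names = tabulate (inj₁ ∘ lift)

      ι-params : ∀ {m} (es : Vec Carrier m) → map ι (map inj₂ es) ≡ map embed es
      ι-params es = ≡.sym (map-∘ ι inj₂ es)

      ι-names : ∀ {m} (es : Vec Carrier m) → map ι (names ++ map inj₂ es) ≡ ps ++ map embed es
      ι-names es = ≡.trans (map-++ ι names (map inj₂ es)) (≡.cong₂ _++_
        (≡.trans (≡.sym (tabulate-∘ ι (inj₁ ∘ lift))) (tabulate∘lookup ps)) (ι-params es))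

      data Conditions : Pred (ParamFormula L 1 Name) ℓ where
        generic  : ∀ {n} (φ : Formula L (suc n)) (as : Vec Carrier n) → type (n , φ , as) →
                   Conditions (n , φ , map inj₂ as)
        property : ∀ {m} (es : Vec Carrier m) → Conditions (k ℕ.+ m , ψ m , names ++ map inj₂ es)

      Handles : ∀ {m} → Vec Carrier m → ParamFormula L 1 Name → Set _
      Handles {m} es θ = ∀ x → New M̄ (map embed es) x → x ∷ (ps ++ map embed es) ⊨ᴺ ψ m → Solutions M̄ ι θ x

      handles-⊑ : ∀ {m m′} (es : Vec Carrier m) (es′ : Vec Carrier m′) θ → es ⊑ es′ → Handles es θ → Handles es′ θ
      handles-⊑ es es′ θ es⊑es′ handles x new h =
        let es⊑es′ᴺ = ⊑-map {es = es} {es′} es⊑es′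
        in handles x (new-⊑ (map embed es) (map embed es′) es⊑es′ᴺ new) (anti (x ∷ ps) es⊑es′ᴺ h)

      handle : ∀ {θ} → Conditions θ → ∃[ m ] Σ[ es ∈ Vec Carrier m ] Handles es θ
      handle (generic φ as φ∈p) = let m , es , holds = generic-excludes φ as φ∈p in
        m , es , λ x new _ → ≡.subst (λ bs → x ∷ bs ⊨ᴺ φ) (≡.sym (ι-params as)) (holds x new)
      handle (property {m} es) = m , es , λ x _ h →
        ≡.subst (λ bs → x ∷ bs ⊨ᴺ ψ m) (≡.sym (ι-names es)) h

      handle-all : ∀ {θs} → All Conditions θs → ∃[ m ] Σ[ es ∈ Vec Carrier m ] All (Handles es) θs
      handle-all []       = 0 , [] , []
      handle-all {θ ∷ _} (c ∷ cs) =
        let m  , es  , h  = handle c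
            m′ , es′ , hs = handle-all cs
        in m ℕ.+ m′ , es ++ es′ , handles-⊑ es (es ++ es′) θ (++-⊑ˡ es es′) h ∷ weaken es es′ hs
        where
        weaken : ∀ {m m′} (es : Vec Carrier m) (es′ : Vec Carrier m′) {θs} →
                 All (Handles es′) θs → All (Handles (es ++ es′)) θs
        weaken es es′ []       = []
        weaken es es′ {θ ∷ _} (h ∷ hs) = handles-⊑ es′ (es ++ es′) θ (++-⊑ʳ es es′) h ∷ weaken es es′ hs

      finitely-satisfiable : FinitelySatisfiable M̄ ι Conditions
      finitely-satisfiable θs cs =
        let m , es , hs = handle-all cs
            x , d , h   = satisfiable m es
        in x , apply es hs (new⁻ M̄ ps (map embed es) d) h
        where
        apply : ∀ {m} (es : Vec Carrier m) {θs x} → All (Handles es) θs → New M̄ (map embed es) x →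
                x ∷ (ps ++ map embed es) ⊨ᴺ ψ m → All (λ θ → Solutions M̄ ι θ x) θs
        apply es []       new h = []
        apply es (f ∷ fs) new h = f _ new h ∷ apply es fs new h

    -- Finitely many conditions exclude finitely many elements, so a witness of `satisfiable` meets
    -- them and saturation applies. When `ψ` is again of the form `∃̇-new`, the last component is
    -- the hypothesis for choosing the next point.
    generic-realisation : ∃[ x ] Realises M̄ embed type x ×
                          (∀ m (es : Vec Carrier m) → x ∷ (ps ++ map embed es) ⊨ᴺ ψ m)
    generic-realisation =
      let x , real = saturated Name ι Conditions finitely-satisfiable in
      x , (λ { (n , φ , as) φ∈p → ≡.subst (λ bs → x ∷ bs ⊨ᴺ φ) (ι-params as) (real _ (generic φ as φ∈p)) })
        , (λ m es → ≡.subst (λ bs → x ∷ bs ⊨ᴺ ψ m) (ι-names es) (real _ (property es)))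

-- From almost linear orders to almost weak orders

module DefinableSets {L : Language ℓ} (M : Structure L ℓ) (min : IsMinimal M) where
  open Structure M using (Carrier; setoid)
  open FiniteSets setoid

  definable-minimal : ∀ {n} (φ : Formula L (suc n)) (as : Vec Carrier n) {P : Pred Carrier ℓ} →
                      (∀ x → P x → _⊨_ M (x ∷ as) φ) → (∀ x → _⊨_ M (x ∷ as) φ → P x) →
                      Finite setoid P ⊎ Cofinite P
  definable-minimal φ as P⇒φ φ⇒P = Sum.map
    (⊆-finite (λ {x} → ≡.subst (λ bs → _⊨_ M (x ∷ bs) φ) (≡.sym (map-id as)) ∘ P⇒φ x))
    (⊆-finite (λ {x} ¬P → ¬P ∘ φ⇒P x ∘ ≡.subst (λ bs → _⊨_ M (x ∷ bs) φ) (map-id as)))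
    (IsMinimal.minimal min (_ , φ , as))

module AlmostLinearOrders
  (em : ∀ {a} → ExcludedMiddle a) {L : Language ℓ} (M : Structure L ℓ) (min : IsMinimal M)
  (𝕄 : Monster M) (p : GenericType M) (φ : ParamFormula L 2 (Structure.Carrier M))
  (almostLinear : IsAlmostLinearOrder M 𝕄 p φ) where
  open Structure M using (Carrier; setoid; _≈_)
  open FiniteSets setoid
  open Monster 𝕄
  open IsAlmostLinearOrder almostLinear
  open GenericRealisations em M min 𝕄 p
  open IsStrictPartialOrder isStrictPartialOrder using (<-respˡ-≈; <-respʳ-≈)

  private
    r : ℕ
    r = proj₁ φ

    F : Formula L (2 ℕ.+ r)
    F = proj₁ (proj₂ φ)

    -- The map by `id` is kept because `_<ᴹ_` unfolds to this form.
    cs : Vec Carrier r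
    cs = map id (proj₂ (proj₂ φ))

    c̄s : Vec N.Carrier r
    c̄s = map embed (proj₂ (proj₂ φ))

    module M = Structure M

  position : ∀ {N} → Fin N → Fin N → (Fin r → Fin N) → Fin (2 ℕ.+ r) → Fin N
  position i j params zero          = i
  position i j params (suc zero)    = j
  position i j params (suc (suc t)) = params t

  order-formula : ∀ {N} → Fin N → Fin N → (Fin r → Fin N) → Formula L N
  order-formula i j params = ren (position i j params) F

  module _ {c} (S : Structure L c) {N} (ρ : Vec (Structure.Carrier S) N) (ds : Vec (Structure.Carrier S) r)
           (i j : Fin N) (params : Fin r → Fin N) (eq : ∀ t → lookup ρ (params t) ≡ lookup ds t) where
    private
      renames : Renames S (position i j params) ρ (lookup ρ i ∷ lookup ρ j ∷ ds)
      renames zero          = ≡.refl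
      renames (suc zero)    = ≡.refl
      renames (suc (suc t)) = eq t

    order-formula⁻ : _⊨_ S ρ (order-formula i j params) → _⊨_ S (lookup ρ i ∷ lookup ρ j ∷ ds) F
    order-formula⁻ = ⊨-ren⁻ S renames F

    order-formula⁺ : _⊨_ S (lookup ρ i ∷ lookup ρ j ∷ ds) F → _⊨_ S ρ (order-formula i j params)
    order-formula⁺ = ⊨-ren⁺ S renames F

  -- The formula ∃ v u (u = s ∧ v = t ∧ u < v); terms are only renamed, never substituted.
  comparison-minimal : ∀ {k} (s t : Term L (suc k)) (bs : Vec Carrier k) →
    let D = λ x → eval M (x ∷ bs) s <ᴹ eval M (x ∷ bs) t in Finite setoid D ⊎ Cofinite D
  comparison-minimal {k} s t bs = DefinableSets.definable-minimal M min
    (∃̇ ∃̇ (var (suc zero) ≈̇ shift s ∧̇ var zero ≈̇ shift t ∧̇ order-formula (suc zero) zero params))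
    (bs ++ cs)
    (λ x s<t → eval M (x ∷ bs) s , eval M (x ∷ bs) t
             , M.reflexive (≡.sym (shift-eval x s)) , M.reflexive (≡.sym (shift-eval x t))
             , order-formula⁺ M _ cs (suc zero) zero params (lookup-++ʳ bs cs) s<t)
    (λ x (u , v , u≈s , v≈t , u<v) →
      <-respˡ-≈ (M.trans u≈s (M.reflexive (shift-eval x s)))
        (<-respʳ-≈ (M.trans v≈t (M.reflexive (shift-eval x t)))
          (order-formula⁻ M _ cs (suc zero) zero params (lookup-++ʳ bs cs) u<v)))
    where
    params : Fin r → Fin (3 ℕ.+ (k ℕ.+ r))
    params i = 3 ↑ʳ (k ↑ʳ i)

    shift : Term L (suc k) → Term L (3 ℕ.+ (k ℕ.+ r))
    shift = renᵗ λ i → 2 ↑ʳ (i ↑ˡ r)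

    shift-eval : ∀ x t {u v} → eval M (v ∷ u ∷ x ∷ (bs ++ cs)) (shift t) ≡ eval M (x ∷ bs) t
    shift-eval x t = eval-ren M (lookup-++ˡ (x ∷ bs) cs) t

  beyond : ∀ {k} → Fin r → Fin (3 ℕ.+ r ℕ.+ k)
  beyond t = 3 ↑ʳ (t ↑ˡ _)

  -- The variables 2, 1, 0 stand for x, y, z, listed in order of choice.
  broken : Family (3 ℕ.+ r)
  broken m = (lt x y ⇒̇ ⊥̇) ∧̇ (lt y x ⇒̇ ⊥̇) ∧̇ (lt y z ⇒̇ ⊥̇) ∧̇ (lt z y ⇒̇ ⊥̇) ∧̇ lt x z
    where
    x y z : Fin (3 ℕ.+ r ℕ.+ m)
    x = suc (suc zero)
    y = suc zero
    z = zero
    lt : Fin (3 ℕ.+ r ℕ.+ m) → Fin (3 ℕ.+ r ℕ.+ m) → Formula L (3 ℕ.+ r ℕ.+ m)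
    lt i j = order-formula i j beyond

  -- A failure of transitivity of incomparability. One direction between `x` and `z` is enough,
  -- since the other is a failure for the reversed triple.
  Broken : ∀ {c} {A : Set c} → Rel A c → A → A → A → Set c
  Broken _<_ x y z = Incomparable _<_ x y × Incomparable _<_ y z × x < z

  module _ {c} (S : Structure L c) (ds : Vec (Structure.Carrier S) r) {m} (es : Vec (Structure.Carrier S) m)
           {x y z : Structure.Carrier S} where
    private
      ρ : Vec (Structure.Carrier S) (3 ℕ.+ r ℕ.+ m)
      ρ = z ∷ y ∷ x ∷ (ds ++ es)

      lt⁻ : ∀ i j → _⊨_ S ρ (order-formula i j beyond) → _⊨_ S (lookup ρ i ∷ lookup ρ j ∷ ds) F
      lt⁻ i j = order-formula⁻ S ρ ds i j beyond (lookup-++ˡ ds es)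

      lt⁺ : ∀ i j → _⊨_ S (lookup ρ i ∷ lookup ρ j ∷ ds) F → _⊨_ S ρ (order-formula i j beyond)
      lt⁺ i j = order-formula⁺ S ρ ds i j beyond (lookup-++ˡ ds es)

    broken⁻ : _⊨_ S ρ (broken m) → Broken (λ u v → _⊨_ S (u ∷ v ∷ ds) F) x y z
    broken⁻ (¬xy , ¬yx , ¬yz , ¬zy , xz) =
      [ lower ∘ ¬xy ∘ lt⁺ (suc (suc zero)) (suc zero) , lower ∘ ¬yx ∘ lt⁺ (suc zero) (suc (suc zero)) ] ,
      [ lower ∘ ¬yz ∘ lt⁺ (suc zero) zero , lower ∘ ¬zy ∘ lt⁺ zero (suc zero) ] ,
      lt⁻ (suc (suc zero)) zero xz

    broken⁺ : Broken (λ u v → _⊨_ S (u ∷ v ∷ ds) F) x y z → _⊨_ S ρ (broken m)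
    broken⁺ (x∼y , y∼z , xz) =
      lift ∘ x∼y ∘ inj₁ ∘ lt⁻ (suc (suc zero)) (suc zero) ,
      lift ∘ x∼y ∘ inj₂ ∘ lt⁻ (suc zero) (suc (suc zero)) ,
      lift ∘ y∼z ∘ inj₁ ∘ lt⁻ (suc zero) zero ,
      lift ∘ y∼z ∘ inj₂ ∘ lt⁻ zero (suc zero) ,
      lt⁺ (suc (suc zero)) zero xz

  broken-antitone : Antitone broken
  broken-antitone (z ∷ y ∷ x ∷ ds) {es = es} {es′} _ h = broken⁺ M̄ ds es (broken⁻ M̄ ds es′ h)

  -- At each stage the formula says that the points still to be chosen exist outside any given
  -- finite set. The three generic points so obtained contradict transitivity on the realisations.
  broken-avoidable : ¬ (∀ {m} (es : Vec Carrier m) → ∃[ x ] ∃[ y ] ∃[ z ]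
                        New M es x × New M es y × New M es z × Broken _<ᴹ_ x y z)
  broken-avoidable everywhere =
    let ψ₂ = ∃̇-new broken
        ψ₁ = ∃̇-new ψ₂
        anti₂ = ∃̇-new-antitone {ψ = broken} broken-antitone
        anti₁ = ∃̇-new-antitone {ψ = ψ₂} anti₂
        a , a∈p , h₁ = generic-realisation {ψ = ψ₁} anti₁ c̄s satisfiable
        b , b∈p , h₂ = generic-realisation {ψ = ψ₂} anti₂ (a ∷ c̄s) h₁
        c , c∈p , h₃ = generic-realisation {ψ = broken} broken-antitone (b ∷ a ∷ c̄s) h₂
        a∼b , b∼c , a<c = broken⁻ M̄ c̄s [] (h₃ 0 [])
    in IsEquivalence.trans ∼-isEquivalence {a , a∈p} {b , b∈p} {c , c∈p} a∼b b∼c (inj₁ a<c)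
    where
    satisfiable : ∀ m (es : Vec Carrier m) → _⊨_ M̄ (c̄s ++ map embed es) (∃̇-new (∃̇-new (∃̇-new broken)) m)
    satisfiable m es = ≡.subst (λ ds → _⊨_ M̄ ds ψ)
      (≡.trans (map-++ embed cs es) (≡.cong (λ ds → map embed ds ++ map embed es) (map-id (proj₂ (proj₂ φ)))))
      (Equivalence.to (elementary ψ (cs ++ es))
        (let x , y , z , x-new , y-new , z-new , xyz = everywhere es in
         x , new⁺ M cs es x-new , y , new⁺ M (x ∷ cs) es y-new , z , new⁺ M (y ∷ x ∷ cs) es z-new , broken⁺ M cs es xyz))
      where
      ψ = ∃̇-new (∃̇-new (∃̇-new broken)) m

  exceptions : ∃[ m ] Σ[ es ∈ Vec Carrier m ] ∀ {x y z} →
               New M es x → New M es y → New M es z → ¬ Broken _<ᴹ_ x y z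
  exceptions = decidable-stable em λ none → broken-avoidable λ {m} es → decidable-stable em λ unbroken →
    none (m , es , λ {x} {y} {z} x-new y-new z-new xyz → unbroken (x , y , z , x-new , y-new , z-new , xyz))

  almostWeakOrder′ : ∀ {m} (es : Vec Carrier m) →
                     (∀ {x y z} → New M es x → New M es y → New M es z → ¬ Broken _<ᴹ_ x y z) →
                     AlmostWeakOrder setoid
  almostWeakOrder′ es unbroken = record
    { _≺_                  = _<ᴹ_
    ; isStrictPartialOrder = isStrictPartialOrder
    ; generic              = New M es
    ; generic-cofinite     = List.tabulate (lookup es) , λ x old →
        let i , x≈eᵢ = decidable-stable em λ new → old λ i x≈eᵢ → new (i , x≈eᵢ)
        in Mem.∈-resp-≈ setoid (M.sym x≈eᵢ) (Mem.∈-tabulate⁺ setoid i)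
    ; ∼-trans              = λ gx gy gz x∼y y∼z →
        [ (λ x<z → unbroken gx gy gz (x∼y , y∼z , x<z))
        , (λ z<x → unbroken gz gy gx (y∼z ∘ Sum.swap , x∼y ∘ Sum.swap , z<x)) ]
    ; chain                = proj₁ infiniteChain
    ; chain-infinite       = proj₁ (proj₂ infiniteChain)
    ; chain-linear         = proj₂ (proj₂ infiniteChain)
    ; below-minimal        = λ y → comparison-minimal (var zero) (var (suc zero)) (y ∷ [])
    ; above-minimal        = λ y → comparison-minimal (var (suc zero)) (var zero) (y ∷ [])
    }

  almostWeakOrder : Σ[ order ∈ AlmostWeakOrder setoid ]
    (∀ {k} (s t : Term L (suc k)) (bs : Vec Carrier k) →
     let D = λ x → AlmostWeakOrder._≺_ order (eval M (x ∷ bs) s) (eval M (x ∷ bs) t) in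
     Finite setoid D ⊎ Cofinite D)
  almostWeakOrder = let _ , es , unbroken = exceptions in almostWeakOrder′ es unbroken , comparison-minimal

-- The classification

module MinimalGroup
  (em : ∀ {a} → ExcludedMiddle a) {L : Language ℓ} (G : ExpandedGroup L)
  (min : IsMinimal (ExpandedGroup.structure G)) where
  open ExpandedGroup G using (structure; mul; group)
  open Group group hiding (_-_)
  open FiniteSets setoid
  open DefinableSets structure min
  open Centralisers group using (Central; Commutes; Conjugate)

  infinite : Infinite setoid (U {A = Carrier})
  infinite = IsMinimal.infinite min

  infixl 7 _∙ᵗ_
  _∙ᵗ_ : ∀ {n} → Term L n → Term L n → Term L n
  s ∙ᵗ t = app mul (s ∷ t ∷ [])

  -- The variable e stands for the identity, for which the language has no symbol.
  multipleᵗ : ∀ {n} (e : Fin n) → ℕ → Term L n → Term L n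
  multipleᵗ e zero    t = var e
  multipleᵗ e (suc n) t = t ∙ᵗ multipleᵗ e n t

  commutative : Commutative _≈_ _∙_
  commutative = MinimalGroupsAbelian.commutative em group infinite
    (λ a → definable-minimal (v₀ ∙ᵗ v₁ ≈̇ v₁ ∙ᵗ v₀) (a ∷ []) (λ _ → id) (λ _ → id))
    (definable-minimal (∀̇ (v₁ ∙ᵗ v₀ ≈̇ v₀ ∙ᵗ v₁)) [] (λ _ → id) (λ _ → id))
    (λ a → definable-minimal (∃̇ (v₀ ∙ᵗ v₂ ≈̇ v₁ ∙ᵗ v₀)) (a ∷ []) (λ _ → id) (λ _ → id))
    where
    v₀ : ∀ {n} → Term L (suc n)
    v₀ = var zero
    v₁ : ∀ {n} → Term L (suc (suc n))
    v₁ = var (suc zero)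
    v₂ : ∀ {n} → Term L (suc (suc (suc n)))
    v₂ = var (suc (suc zero))

  abelianGroup : AbelianGroup ℓ ℓ
  abelianGroup = record { isAbelianGroup = record { isGroup = isGroup ; comm = commutative } }

  open AbelianGroupProperties abelianGroup
  open Multiples abelianGroup
  open InfiniteGroup em group infinite

  eval-multiple : ∀ {m} (ρ : Vec Carrier m) {e t} → eval structure ρ (var e) ≡ ε →
                  ∀ n → eval structure ρ (multipleᵗ e n t) ≡ n · eval structure ρ t
  eval-multiple ρ         e≡ε zero    = e≡ε
  eval-multiple ρ {t = t} e≡ε (suc n) = ≡.cong (eval structure ρ t ∙_) (eval-multiple ρ e≡ε n)

  socle-minimal : ∀ n → Finite setoid (λ x → n · x ≈ ε) ⊎ Cofinite (λ x → n · x ≈ ε)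
  socle-minimal n = definable-minimal (multipleᵗ (suc zero) n (var zero) ≈̇ var (suc zero)) (ε ∷ [])
    (λ x → ≡.subst (_≈ ε) (≡.sym (eval-multiple (x ∷ ε ∷ []) ≡.refl n)))
    (λ x → ≡.subst (_≈ ε) (eval-multiple (x ∷ ε ∷ []) ≡.refl n))

  multiples-minimal : ∀ n → Finite setoid (λ y → ∃[ x ] n · x ≈ y) ⊎ Cofinite (λ y → ∃[ x ] n · x ≈ y)
  multiples-minimal n = definable-minimal (∃̇ (multipleᵗ (suc (suc zero)) n (var zero) ≈̇ var (suc zero))) (ε ∷ [])
    (λ y (x , eq) → x , ≡.subst (_≈ y) (≡.sym (eval-multiple (x ∷ y ∷ ε ∷ []) ≡.refl n)) eq)
    (λ y (x , eq) → x , ≡.subst (_≈ y) (eval-multiple (x ∷ y ∷ ε ∷ []) ≡.refl n) eq)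

  -- An infinite socle is cofinite by minimality, and a cofinite subgroup is everything.
  infinite-socle⇒annihilates : ∀ {n} → Infinite setoid (λ x → n · x ≈ ε) → ∀ x → n · x ≈ ε
  infinite-socle⇒annihilates {n} inf with socle-minimal n
  ... | inj₁ fin = contradiction fin inf
  ... | inj₂ cof = cofinite-subgroup-full
        (λ x y nxy≈ε ny≈ε → trans (sym (identityʳ _)) (trans (∙-congˡ (sym ny≈ε)) (trans (sym (×-distrib-+ x y n)) nxy≈ε)))
        cof

  -- Finite fibres make the image of `n ·_` infinite, hence a cofinite subgroup.
  finite-socle⇒divisible : ∀ {n} → Finite setoid (λ x → n · x ≈ ε) → ∀ y → ∃[ x ] n · x ≈ y
  finite-socle⇒divisible {n} socle-finite with multiples-minimal n
  ... | inj₁ fin = contradiction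
        (⊆-finite (λ {x} _ → x , refl) (preimage-finite (n ·_) fin
          (MultiplicationFibres.fibre-finite em abelianGroup n socle-finite)))
        infinite
  ... | inj₂ cof = cofinite-subgroup-full
        (λ x y (u , nu≈xy) (v , nv≈y) → u ∙ v ⁻¹ ,
          trans (×-distrib-+ u (v ⁻¹) n) (trans (∙-cong nu≈xy (trans (·-⁻¹ n v) (⁻¹-cong nv≈y))) (//-rightDividesʳ y x)))
        cof

  annihilated⇒elementaryAbelian : ∀ {p} → Prime p → (∀ x → p · x ≈ ε) → IsElementaryAbelian group p
  annihilated⇒elementaryAbelian {p} p-prime annihilates = commutative , record
    { positive    = ℕ.>-nonZero⁻¹ p
    ; annihilates = annihilates
    -- A smaller positive `k` is coprime to `p`, so it could annihilate only a trivial group.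
    ; least       = λ k 0<k k-annihilates → ℕ.≮⇒≥ λ k<p → infinite (⊆-finite
        (λ {x} _ → coprime-annihilators (prime⇒coprime p-prime {{ℕ.>-nonZero 0<k}} k<p) (annihilates x) (k-annihilates x))
        (≈-finite ε))
    }
    where
    instance
      p≢0 : NonZero p
      p≢0 = prime⇒nonZero p-prime

  ComparisonMinimal : AlmostWeakOrder (Structure.setoid structure) → Set ℓ
  ComparisonMinimal order = ∀ {k} (s t : Term L (suc k)) (bs : Vec Carrier k) →
    let D = λ x → AlmostWeakOrder._≺_ order (eval structure (x ∷ bs) s) (eval structure (x ∷ bs) t) in
    Finite setoid D ⊎ Cofinite D

  module _ (order′ : AlmostWeakOrder (Structure.setoid structure)) (comparison-minimal : ComparisonMinimal order′) where

    -- The setoids of the structure and of the group share ≈ but not the proof that it is an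
    -- equivalence.
    order : AlmostWeakOrder setoid
    order = record { AlmostWeakOrder order′ }

    open AlmostWeakOrder order
    open OrderDichotomy em order using (Drift; drift)

    translation-drift : ∀ g → Drift (g ∙_)
    translation-drift g = drift (g ∙_)
      (comparison-minimal (var zero) (var (suc zero) ∙ᵗ var zero) (g ∷ []))
      (comparison-minimal (var (suc zero) ∙ᵗ var zero) (var zero) (g ∷ []))

    multiple-drift : ∀ n → Drift (n ·_)
    multiple-drift n = drift (n ·_)
      (Sum.map (⊆-finite (λ {x} → ≡.subst (x ≺_) (≡.sym (n·≡ x)))) (⊆-finite (λ {x} → _∘ ≡.subst (x ≺_) (n·≡ x)))
        (comparison-minimal (var zero) (multipleᵗ (suc zero) n (var zero)) (ε ∷ [])))
      (Sum.map (⊆-finite (λ {x} → ≡.subst (_≺ x) (≡.sym (n·≡ x)))) (⊆-finite (λ {x} → _∘ ≡.subst (_≺ x) (n·≡ x)))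
        (comparison-minimal (multipleᵗ (suc zero) n (var zero)) (var zero) (ε ∷ [])))
      where
      n·≡ : ∀ x → eval structure (x ∷ ε ∷ []) (multipleᵗ (suc zero) n (var zero)) ≡ n · x
      n·≡ x = eval-multiple (x ∷ ε ∷ []) ≡.refl n

    classification : (∃[ p ] (Prime p × (IsElementaryAbelian group p ⊎ IsFiniteSumOfPrüfer p group)))
                     × IsTorsion group
    classification with em {P = ∃[ p ] Prime p × Infinite setoid (λ x → p · x ≈ ε)}
    ... | yes (p , p-prime , inf) =
          (p , p-prime , inj₁ (annihilated⇒elementaryAbelian p-prime (infinite-socle⇒annihilates {p} inf)))
          , λ x → p , ℕ.>-nonZero⁻¹ p {{prime⇒nonZero p-prime}} , infinite-socle⇒annihilates {p} inf x
    ... | no none =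
          let p , p-prime , iso = OrderedDivisibleGroup.isFiniteSumOfPrüferGroups em abelianGroup order
                infinite divisible socle-finite translation-drift multiple-drift
          in (p , p-prime , inj₂ iso) , OrderedDivisibleGroup.torsion em abelianGroup order
               infinite divisible socle-finite translation-drift multiple-drift
      where
      socle-finite : ∀ {q} → Prime q → Finite setoid (λ x → q · x ≈ ε)
      socle-finite {q} q-prime = decidable-stable em λ inf → none (q , q-prime , inf)

      divisible : ∀ {q} → Prime q → ∀ y → ∃[ x ] q · x ≈ y
      divisible {q} q-prime = finite-socle⇒divisible {q} (socle-finite q-prime)

theorem2 :
    (∀ {a} → ExcludedMiddle a) →
    ∀ {ℓ} (L : Language ℓ) (G : ExpandedGroup L) →
    let M = ExpandedGroup.structure G
        H = ExpandedGroup.group G in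
    IsMinimal M →
    (𝕄 : Monster M) (g : GenericType M) →
    AlmostLinear M 𝕄 g →
    (∃[ p ] (Prime p × (IsElementaryAbelian H p ⊎ IsFiniteSumOfPrüfer p H)))
    × IsTorsion H
theorem2 em L G min 𝕄 g (φ , almostLinear) =
  let order , comparison-minimal = AlmostLinearOrders.almostWeakOrder
        em (ExpandedGroup.structure G) min 𝕄 g φ almostLinear
  in MinimalGroup.classification em G min order comparison-minimal
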